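{- Let $p$ and $q$ be distinct odd primes and $N=pq$, with $N\notin\{15,21,39,55\}$. Suppose there is an elliptic curve over $\mathbb{Q}$ of conductor $N$ having a rational point of order $2$. Then, possibly after interchanging $p$ and $q$, at least one of the following Diophantine equations has an integral solution $(A,a,b)$ with $a,b>0$ (where in each equation the signs $\pm$ may be chosen independently, except as specified in (5)): (1) $1=2^{4}q^{b}-p^{a}$; (2) $|p^{a}-q^{b}|=16$; (3) $A^{2}+64=p^{a}q^{b}$; (4) $A^{2}\pm64q^{b}=\pm p^{a}$; (5) $A^{2}\pm4q^{b}=\pm256p^{a}$ together with $q^{b}\equiv\pm1\pmod 8$, where the sign in this congruence is the opposite of the sign in front of $4q^{b}$; (6) $A^{2}\pm4p^{a}q^{b}=\pm256$; (7) $A^{2}\pm64p^{a}q^{b}=\pm1$. -}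

module Defs where

open import Data.Nat as ℕ using (ℕ)
open import Data.Nat.Primality using (Prime)
open import Data.Nat.Divisibility using (_∣_)
open import Data.Integer as ℤ using (ℤ; +_)
open import Data.Integer.Divisibility using () renaming (_∣_ to _∣ℤ_)
open import Data.Rational as ℚ using (ℚ; ↥_; ↧_; _/_; _+_; _-_; _*_; -_)
open import Data.Sign using (Sign)
open import Data.Product using (Σ; ∃; _×_; _,_)
open import Data.Sum using (_⊎_)
open import Relation.Binary.PropositionalEquality using (_≡_; _≢_)
open import Relation.Nullary using (¬_)

ι : ℤ → ℚ
ι z = z / 1

-- Weierstrass equations over ℚ:
--   y² + a₁xy + a₃y = x³ + a₂x² + a₄x + a₆

record Weierstrass : Set where
  constructor mkW
  field
    a₁ a₂ a₃ a₄ a₆ : ℚ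

module Invariants (E : Weierstrass) where
  open Weierstrass E

  b₂ b₄ b₆ b₈ c₄ Δ : ℚ
  b₂ = a₁ * a₁ + ι (+ 4) * a₂
  b₄ = ι (+ 2) * a₄ + a₁ * a₃
  b₆ = a₃ * a₃ + ι (+ 4) * a₆
  b₈ = a₁ * a₁ * a₆ + ι (+ 4) * a₂ * a₆ - a₁ * a₃ * a₄ + a₂ * a₃ * a₃ - a₄ * a₄
  c₄ = b₂ * b₂ - ι (+ 24) * b₄
  Δ  = - (b₂ * b₂ * b₈) - ι (+ 8) * (b₄ * b₄ * b₄) - ι (+ 27) * (b₆ * b₆)
       + ι (+ 9) * b₂ * b₄ * b₆

open Invariants public

record EllipticCurve : Set where
  field
    eqn  : Weierstrass
    Δ≢0  : Δ eqn ≢ ι (+ 0)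
open EllipticCurve public

-- Two Weierstrass equations are isomorphic over ℚ if related by the standard
-- change of variables x = u²x' + r, y = u³y' + su²x' + t (u ≠ 0).
Isomorphic : Weierstrass → Weierstrass → Set
Isomorphic E E' =
  Σ ℚ λ u → Σ ℚ λ r → Σ ℚ λ s → Σ ℚ λ t →
    u ≢ ι (+ 0) ×
    u * a₁' ≡ a₁ + ι (+ 2) * s ×
    u * u * a₂' ≡ a₂ - s * a₁ + ι (+ 3) * r - s * s ×
    u * u * u * a₃' ≡ a₃ + r * a₁ + ι (+ 2) * t ×
    u * u * u * u * a₄' ≡ a₄ - s * a₃ + ι (+ 2) * r * a₂ - (t + r * s) * a₁
                          + ι (+ 3) * r * r - ι (+ 2) * s * t ×
    u * u * u * u * u * u * a₆' ≡ a₆ + r * a₄ + r * r * a₂ + r * r * r - t * a₃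
                                  - t * t - r * t * a₁
  where
    open Weierstrass E
    open Weierstrass E' renaming (a₁ to a₁'; a₂ to a₂'; a₃ to a₃'; a₄ to a₄'; a₆ to a₆')

IntegralAt : ℕ → ℚ → Set
IntegralAt ℓ x = ¬ ((+ ℓ) ∣ℤ (↧ x))

-- ℓ divides an ℓ-integral rational x (i.e. x ≡ 0 mod ℓ in ℤ_(ℓ))
DividesAt : ℕ → ℚ → Set
DividesAt ℓ x = (+ ℓ) ∣ℤ (↥ x)

IntegralModelAt : ℕ → Weierstrass → Set
IntegralModelAt ℓ E = IntegralAt ℓ a₁ × IntegralAt ℓ a₂ × IntegralAt ℓ a₃
                    × IntegralAt ℓ a₄ × IntegralAt ℓ a₆
  where open Weierstrass E

GoodReductionAt : ℕ → EllipticCurve → Set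
GoodReductionAt ℓ E = Σ Weierstrass λ W →
  Isomorphic (eqn E) W × IntegralModelAt ℓ W × ¬ DividesAt ℓ (Δ W)

-- Multiplicative reduction at ℓ: some ℓ-integral model has ℓ ∣ Δ and ℓ ∤ c₄
-- (such a model is automatically ℓ-minimal).
MultiplicativeReductionAt : ℕ → EllipticCurve → Set
MultiplicativeReductionAt ℓ E = Σ Weierstrass λ W →
  Isomorphic (eqn E) W × IntegralModelAt ℓ W × DividesAt ℓ (Δ W) × ¬ DividesAt ℓ (c₄ W)

-- E has conductor N, for N squarefree: conductor exponent 0 (good reduction)
-- at primes ℓ ∤ N and conductor exponent 1 (multiplicative reduction) at ℓ ∣ N.
HasSquarefreeConductor : EllipticCurve → ℕ → Set
HasSquarefreeConductor E N = (ℓ : ℕ) → Prime ℓ →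
  (¬ (ℓ ∣ N) → GoodReductionAt ℓ E) × (ℓ ∣ N → MultiplicativeReductionAt ℓ E)

-- A rational point of order 2: an affine point P = (x , y) with P = -P,
-- where -(x , y) = (x , - y - a₁x - a₃).
HasRationalPointOfOrder2 : EllipticCurve → Set
HasRationalPointOfOrder2 E = Σ ℚ λ x → Σ ℚ λ y →
    (y * y + a₁ * x * y + a₃ * y ≡ x * x * x + a₂ * x * x + a₄ * x + a₆)
  × (y ≡ - y - a₁ * x - a₃)
  where open Weierstrass (eqn E)

sgn : Sign → ℤ
sgn Sign.+ = + 1
sgn Sign.- = ℤ.- (+ 1)

Eqns : ℕ → ℕ → ℤ → ℕ → ℕ → Set
Eqns p q A a b =
    (+ 1 ≡ + 16 ℤ.* Q ℤ.- P)
  ⊎ (ℤ.∣ P ℤ.- Q ∣ ≡ 16)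
  ⊎ (A ℤ.* A ℤ.+ + 64 ≡ P ℤ.* Q)
  ⊎ (∃ λ s₁ → ∃ λ s₂ → A ℤ.* A ℤ.+ sgn s₁ ℤ.* (+ 64 ℤ.* Q) ≡ sgn s₂ ℤ.* P)
  ⊎ (∃ λ s₁ → ∃ λ s₂ → (A ℤ.* A ℤ.+ sgn s₁ ℤ.* (+ 4 ℤ.* Q) ≡ sgn s₂ ℤ.* (+ 256 ℤ.* P))
                       × (+ 8 ∣ℤ (Q ℤ.+ sgn s₁)))
  ⊎ (∃ λ s₁ → ∃ λ s₂ → A ℤ.* A ℤ.+ sgn s₁ ℤ.* (+ 4 ℤ.* P ℤ.* Q) ≡ sgn s₂ ℤ.* + 256)
  ⊎ (∃ λ s₁ → ∃ λ s₂ → A ℤ.* A ℤ.+ sgn s₁ ℤ.* (+ 64 ℤ.* P ℤ.* Q) ≡ sgn s₂ ℤ.* + 1)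
  where
    P Q : ℤ
    P = (+ p) ℤ.^ a
    Q = (+ q) ℤ.^ b

HasSolution : ℕ → ℕ → Set
HasSolution p q = Σ ℤ λ A → Σ ℕ λ a → Σ ℕ λ b → 1 ℕ.≤ a × 1 ℕ.≤ b × Eqns p q A a b

{-# OPTIONS --safe #-}
module Submission where

-- A point of order 2 puts E in the form Y² = X³ + aX² + bX, unique up to (a , b) ↦ (λ²a , λ⁴b); take a, b
-- integral with no k > 1 such that k² ∣ a and k⁴ ∣ b.  At every prime ℓ, E also has an ℓ-integral model with good
-- or multiplicative reduction, hence after clearing denominators another integral pair (a′ , b′), because the
-- abscissa of the point becomes an integral root of a monic cubic.  Neither pair can be reduced at ℓ, so they
-- differ by an ℓ-unit and the reduction type can be read off (a , b): for odd ℓ ∤ pq, ℓ divides neither b nor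
-- e = a² - 4b; for ℓ ∣ pq it divides exactly one of them; at 2 either 16 ∥ b and e is odd, or 256 ∥ e and b is odd.
-- So b and e are, up to these powers of 2, coprime and of the form ±pⁱqʲ, and a² - 4b = e becomes one of the
-- equations.  Only a² - 64 = ±pⁱqʲ is not on the list: it factors as (|a| - 8)(|a| + 8), which leads to
-- |pⁱ - qʲ| = 16, or to pⁱ + qʲ = 16 or pⁱqʲ = 15, i.e. to the excluded values of pq.

open import Defs
open import Data.Empty using (⊥; ⊥-elim)
open import Data.Integer as ℤ using (ℤ; +_; -[1+_])
import Data.Integer.Properties as ℤₚ
open import Data.List using ([]; _∷_)
open import Data.List.Relation.Unary.All as All using (All; []; _∷_)
open import Data.Nat as ℕ using (ℕ; zero; suc; s≤s; z≤n)
open import Data.Nat.Coprimality as Coprimality using (Coprime; coprime-divisor)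
import Data.Nat.Divisibility as ℕᵈ
open import Data.Nat.Primality
  using (Prime; euclidsLemma; prime[2]; prime?; prime⇒irreducible; prime⇒nonZero; prime⇒nonTrivial; ¬prime[1])
import Data.Nat.Properties as ℕₚ
open import Data.Product using (Σ; ∃; _×_; _,_; proj₁; proj₂; map₁; map₂)
open import Data.Rational as ℚ using (ℚ; ↥_; ↧_; 0ℚ)
import Data.Rational.Properties as ℚₚ
open import Data.Rational.Solver as ℚ-Solver using ()
open import Data.Sum as Sum using (_⊎_; inj₁; inj₂; [_,_]′)
open import Function using (_∘_; id)
open import Relation.Binary.PropositionalEquality
open import Relation.Nullary using (¬_; yes; no; contradiction)

-- Passing from an integral model to Y² = X³ + aX² + bX replaces x by 4x up to a shift, which
-- multiplies Δ by 2¹² and c₄ by 2⁴. The new equation has discriminant 16b²e and c₄-invariant 16(a²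
-- - 3b), so b²e = 256Δ and c₄ = e + b. The behaviour at odd primes is read off these two
-- identities, and the 256 is the source of the powers of 2 in the equations. At 2 the first
-- identity is too weak: 2v(b) + v(e) = 8 also allows v(b) = 1, 2, 3. These values are ruled out by
-- showing that b₂ is odd, for then a ≡ 1 + X and b ≡ X modulo 2, and one of a and b is odd. An even
-- b₂ would mean supersingular reduction at 2, where a root of the cubic would need the 2-adic
-- valuation 4/3. The models at different primes are unrelated a priori. Their pairs can be compared
-- because a and b are v² and v⁴ times quantities that depend only on E and on the abscissa x of the
-- point: the translation part of each isomorphism drops out.

record ℤWeierstrass : Set where
  constructor mkℤW
  field
    a₁ a₂ a₃ a₄ a₆ : ℤ

module ℤInvariants (M : ℤWeierstrass) where
  open import Data.Integer using (_+_; _*_; _-_; -_)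
  open ℤWeierstrass M

  b₂ᶻ b₄ᶻ b₆ᶻ b₈ᶻ c₄ᶻ Δᶻ : ℤ
  b₂ᶻ = a₁ * a₁ + + 4 * a₂
  b₄ᶻ = + 2 * a₄ + a₁ * a₃
  b₆ᶻ = a₃ * a₃ + + 4 * a₆
  b₈ᶻ = a₁ * a₁ * a₆ + + 4 * a₂ * a₆ - a₁ * a₃ * a₄ + a₂ * a₃ * a₃ - a₄ * a₄
  c₄ᶻ = b₂ᶻ * b₂ᶻ - + 24 * b₄ᶻ
  Δᶻ  = - (b₂ᶻ * b₂ᶻ * b₈ᶻ) - + 8 * (b₄ᶻ * b₄ᶻ * b₄ᶻ) - + 27 * (b₆ᶻ * b₆ᶻ)
       + + 9 * b₂ᶻ * b₄ᶻ * b₆ᶻ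

  -- The monic cubic 16 ψ₂²(X / 4).
  cubic : ℤ → ℤ
  cubic X = X * X * X + b₂ᶻ * (X * X) + + 8 * b₄ᶻ * X + + 16 * b₆ᶻ

  -- Moving the root X to 0 turns Y² = cubic into Y² = X³ + A X² + B X.
  A B : ℤ → ℤ
  A X = b₂ᶻ + + 3 * X
  B X = + 3 * (X * X) + + 2 * b₂ᶻ * X + + 8 * b₄ᶻ

open ℤInvariants public

module _ where

  open import Data.Integer using (∣_∣)
  open import Data.Nat.Divisibility using (_∣_)
  open import Data.Rational using (mkℚ; toℚᵘ; _+_; _-_; _*_; -_)
  open import Data.Rational.Unnormalised as ℚᵘ using (mkℚᵘ; *≡*)
  import Data.Rational.Unnormalised.Properties as ℚᵘₚ
  open ℚ-Solver.+-*-Solver using (solve; _:=_; _:+_; _:*_; _:-_; :-_; con)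

  -- The embedding of ℤ in ℚ

  toℚᵘ-ι : ∀ z → toℚᵘ (ι z) ℚᵘ.≃ mkℚᵘ z 0
  toℚᵘ-ι z = ℚₚ.toℚᵘ-fromℚᵘ (mkℚᵘ z 0)

  ι-homo-* : ∀ x y → ι (x ℤ.* y) ≡ ι x * ι y
  ι-homo-* x y = ℚₚ.toℚᵘ-injective (begin
    toℚᵘ (ι (x ℤ.* y))        ≈⟨ toℚᵘ-ι (x ℤ.* y) ⟩
    mkℚᵘ x 0 ℚᵘ.* mkℚᵘ y 0    ≈⟨ ℚᵘₚ.*-cong (toℚᵘ-ι x) (toℚᵘ-ι y) ⟨
    toℚᵘ (ι x) ℚᵘ.* toℚᵘ (ι y) ≈⟨ ℚₚ.toℚᵘ-homo-* (ι x) (ι y) ⟨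
    toℚᵘ (ι x * ι y)          ∎)
    where open ℚᵘₚ.≃-Reasoning

  ι-homo-+ : ∀ x y → ι (x ℤ.+ y) ≡ ι x + ι y
  ι-homo-+ x y = ℚₚ.toℚᵘ-injective (begin
    toℚᵘ (ι (x ℤ.+ y))        ≈⟨ toℚᵘ-ι (x ℤ.+ y) ⟩
    mkℚᵘ (x ℤ.+ y) 0          ≡⟨ cong (λ t → mkℚᵘ t 0) (cong₂ ℤ._+_ (ℤₚ.*-identityʳ x) (ℤₚ.*-identityʳ y)) ⟨
    mkℚᵘ x 0 ℚᵘ.+ mkℚᵘ y 0    ≈⟨ ℚᵘₚ.+-cong (toℚᵘ-ι x) (toℚᵘ-ι y) ⟨
    toℚᵘ (ι x) ℚᵘ.+ toℚᵘ (ι y) ≈⟨ ℚₚ.toℚᵘ-homo-+ (ι x) (ι y) ⟨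
    toℚᵘ (ι x + ι y)          ∎)
    where open ℚᵘₚ.≃-Reasoning

  ι-homo‿- : ∀ x → ι (ℤ.- x) ≡ - ι x
  ι-homo‿- x = ℚₚ.toℚᵘ-injective (begin
    toℚᵘ (ι (ℤ.- x))   ≈⟨ toℚᵘ-ι (ℤ.- x) ⟩
    ℚᵘ.- mkℚᵘ x 0      ≈⟨ ℚᵘₚ.-‿cong (toℚᵘ-ι x) ⟨
    ℚᵘ.- toℚᵘ (ι x)    ≈⟨ ℚₚ.toℚᵘ-homo‿- (ι x) ⟨
    toℚᵘ (- ι x)       ∎)
    where open ℚᵘₚ.≃-Reasoning

  ι-homo-- : ∀ x y → ι (x ℤ.- y) ≡ ι x - ι y
  ι-homo-- x y = trans (ι-homo-+ x (ℤ.- y)) (cong (λ t → ι x + t) (ι-homo‿- y))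

  ι-injective : ∀ {x y} → ι x ≡ ι y → x ≡ y
  ι-injective {x} {y} eq with ℚᵘₚ.≃-trans (ℚᵘₚ.≃-sym (toℚᵘ-ι x)) (ℚᵘₚ.≃-trans (ℚᵘₚ.≃-reflexive (cong toℚᵘ eq)) (toℚᵘ-ι y))
  ... | *≡* e = trans (sym (ℤₚ.*-identityʳ x)) (trans e (ℤₚ.*-identityʳ y))

  ↧*≡↥ : ∀ r → ι (↧ r) * r ≡ ι (↥ r)
  ↧*≡↥ r@record{} = ℚₚ.toℚᵘ-injective (begin
    toℚᵘ (ι (↧ r) * r)           ≈⟨ ℚₚ.toℚᵘ-homo-* (ι (↧ r)) r ⟩
    toℚᵘ (ι (↧ r)) ℚᵘ.* toℚᵘ r   ≈⟨ ℚᵘₚ.*-cong (toℚᵘ-ι (↧ r)) (ℚᵘₚ.≃-refl {toℚᵘ r}) ⟩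
    mkℚᵘ (↧ r) 0 ℚᵘ.* toℚᵘ r     ≈⟨ *≡* (trans (ℤₚ.*-identityʳ _) (trans (ℤₚ.*-comm (↧ r) (↥ r))
                                      (cong (↥ r ℤ.*_) (cong +_ (sym (ℕₚ.+-identityʳ _)))))) ⟩
    mkℚᵘ (↥ r) 0                 ≈⟨ toℚᵘ-ι (↥ r) ⟨
    toℚᵘ (ι (↥ r))               ∎)
    where open ℚᵘₚ.≃-Reasoning


  -- Changes of variables and points of order 2

  translate : Weierstrass → ℚ → ℚ → ℚ → Weierstrass
  translate (mkW a₁ a₂ a₃ a₄ a₆) r s t = mkW
    (a₁ + ι (+ 2) * s)
    (a₂ - s * a₁ + ι (+ 3) * r - s * s)
    (a₃ + r * a₁ + ι (+ 2) * t)
    (a₄ - s * a₃ + ι (+ 2) * r * a₂ - (t + r * s) * a₁ + ι (+ 3) * r * r - ι (+ 2) * s * t)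
    (a₆ + r * a₄ + r * r * a₂ + r * r * r - t * a₃ - t * t - r * t * a₁)

  scale : ℚ → Weierstrass → Weierstrass
  scale u (mkW a₁ a₂ a₃ a₄ a₆) = mkW
    (u * a₁) (u * u * a₂) (u * u * u * a₃) (u * u * u * u * a₄) (u * u * u * u * u * u * a₆)

  b₂-translate : ∀ E r s t → b₂ (translate E r s t) ≡ b₂ E + ι (+ 12) * r
  b₂-translate (mkW a₁ a₂ a₃ a₄ a₆) r s t =
    solve 4 (λ a₁ a₂ r s →
        (a₁ :+ con (ι (+ 2)) :* s) :* (a₁ :+ con (ι (+ 2)) :* s)
          :+ con (ι (+ 4)) :* (a₂ :- s :* a₁ :+ con (ι (+ 3)) :* r :- s :* s)
        := a₁ :* a₁ :+ con (ι (+ 4)) :* a₂ :+ con (ι (+ 12)) :* r) refl a₁ a₂ r s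

  b₄-translate : ∀ E r s t →
    b₄ (translate E r s t) ≡ b₄ E + r * b₂ E + ι (+ 6) * r * r
  b₄-translate (mkW a₁ a₂ a₃ a₄ a₆) r s t =
    solve 7 (λ a₁ a₂ a₃ a₄ r s t →
        con (ι (+ 2)) :* (a₄ :- s :* a₃ :+ con (ι (+ 2)) :* r :* a₂ :- (t :+ r :* s) :* a₁
            :+ con (ι (+ 3)) :* r :* r :- con (ι (+ 2)) :* s :* t)
          :+ (a₁ :+ con (ι (+ 2)) :* s) :* (a₃ :+ r :* a₁ :+ con (ι (+ 2)) :* t)
        := (con (ι (+ 2)) :* a₄ :+ a₁ :* a₃) :+ r :* (a₁ :* a₁ :+ con (ι (+ 4)) :* a₂)
          :+ con (ι (+ 6)) :* r :* r) refl a₁ a₂ a₃ a₄ r s t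

  b₆-translate : ∀ E r s t →
    b₆ (translate E r s t) ≡ b₆ E + ι (+ 2) * r * b₄ E + r * r * b₂ E + ι (+ 4) * r * r * r
  b₆-translate (mkW a₁ a₂ a₃ a₄ a₆) r s t =
    solve 7 (λ a₁ a₂ a₃ a₄ a₆ r t →
        (a₃ :+ r :* a₁ :+ con (ι (+ 2)) :* t) :* (a₃ :+ r :* a₁ :+ con (ι (+ 2)) :* t)
          :+ con (ι (+ 4)) :* (a₆ :+ r :* a₄ :+ r :* r :* a₂ :+ r :* r :* r :- t :* a₃
            :- t :* t :- r :* t :* a₁)
        := a₃ :* a₃ :+ con (ι (+ 4)) :* a₆ :+ con (ι (+ 2)) :* r :* (con (ι (+ 2)) :* a₄ :+ a₁ :* a₃)
          :+ r :* r :* (a₁ :* a₁ :+ con (ι (+ 4)) :* a₂) :+ con (ι (+ 4)) :* r :* r :* r)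
      refl a₁ a₂ a₃ a₄ a₆ r t

  b₂-scale : ∀ u E → b₂ (scale u E) ≡ u * u * b₂ E
  b₂-scale u (mkW a₁ a₂ a₃ a₄ a₆) =
    solve 3 (λ u a₁ a₂ →
        (u :* a₁) :* (u :* a₁) :+ con (ι (+ 4)) :* (u :* u :* a₂)
        := u :* u :* (a₁ :* a₁ :+ con (ι (+ 4)) :* a₂)) refl u a₁ a₂

  b₄-scale : ∀ u E → b₄ (scale u E) ≡ u * u * u * u * b₄ E
  b₄-scale u (mkW a₁ a₂ a₃ a₄ a₆) =
    solve 4 (λ u a₁ a₃ a₄ →
        con (ι (+ 2)) :* (u :* u :* u :* u :* a₄) :+ (u :* a₁) :* (u :* u :* u :* a₃)
        := u :* u :* u :* u :* (con (ι (+ 2)) :* a₄ :+ a₁ :* a₃)) refl u a₁ a₃ a₄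

  b₆-scale : ∀ u E → b₆ (scale u E) ≡ u * u * u * u * u * u * b₆ E
  b₆-scale u (mkW a₁ a₂ a₃ a₄ a₆) =
    solve 3 (λ u a₃ a₆ →
        (u :* u :* u :* a₃) :* (u :* u :* u :* a₃) :+ con (ι (+ 4)) :* (u :* u :* u :* u :* u :* u :* a₆)
        := u :* u :* u :* u :* u :* u :* (a₃ :* a₃ :+ con (ι (+ 4)) :* a₆)) refl u a₃ a₆

  b₈-scale : ∀ u E → b₈ (scale u E) ≡ u * u * u * u * u * u * u * u * b₈ E
  b₈-scale u (mkW a₁ a₂ a₃ a₄ a₆) =
    solve 6 (λ u a₁ a₂ a₃ a₄ a₆ →
        let u₂ = u :* u :* a₂
            u₃ = u :* u :* u :* a₃
            u₄ = u :* u :* u :* u :* a₄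
            u₆ = u :* u :* u :* u :* u :* u :* a₆
        in (u :* a₁) :* (u :* a₁) :* u₆ :+ con (ι (+ 4)) :* u₂ :* u₆ :- (u :* a₁) :* u₃ :* u₄
            :+ u₂ :* u₃ :* u₃ :- u₄ :* u₄
        := u :* u :* u :* u :* u :* u :* u :* u :*
           (a₁ :* a₁ :* a₆ :+ con (ι (+ 4)) :* a₂ :* a₆ :- a₁ :* a₃ :* a₄ :+ a₂ :* a₃ :* a₃ :- a₄ :* a₄))
      refl u a₁ a₂ a₃ a₄ a₆

  c₄-scale : ∀ u E → c₄ (scale u E) ≡ u * u * u * u * c₄ E
  c₄-scale u E = trans (cong₂ (λ x y → x * x - ι (+ 24) * y) (b₂-scale u E) (b₄-scale u E))
    (solve 3 (λ u b₂ b₄ →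
        (u :* u :* b₂) :* (u :* u :* b₂) :- con (ι (+ 24)) :* (u :* u :* u :* u :* b₄)
        := u :* u :* u :* u :* (b₂ :* b₂ :- con (ι (+ 24)) :* b₄)) refl u (b₂ E) (b₄ E))

  -- `Δ` as a polynomial in independent b₂, b₄, b₆, b₈: the weight of Δ follows from theirs, without
  -- expanding in the five coefficients.
  discriminant : ℚ → ℚ → ℚ → ℚ → ℚ
  discriminant b₂ b₄ b₆ b₈ = - (b₂ * b₂ * b₈) - ι (+ 8) * (b₄ * b₄ * b₄) - ι (+ 27) * (b₆ * b₆)
         + ι (+ 9) * b₂ * b₄ * b₆

  Δ-scale : ∀ u E → Δ (scale u E) ≡ u * u * u * u * u * u * u * u * u * u * u * u * Δ E
  Δ-scale u E = trans
    (trans (cong₂ (λ x y → discriminant x y (b₆ (scale u E)) (b₈ (scale u E))) (b₂-scale u E) (b₄-scale u E))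
           (cong₂ (discriminant (u * u * b₂ E) (u * u * u * u * b₄ E)) (b₆-scale u E) (b₈-scale u E)))
    (solve 5 (λ u b₂ b₄ b₆ b₈ →
        let v₂ = u :* u :* b₂
            v₄ = u :* u :* u :* u :* b₄
            v₆ = u :* u :* u :* u :* u :* u :* b₆
            v₈ = u :* u :* u :* u :* u :* u :* u :* u :* b₈
        in :- (v₂ :* v₂ :* v₈) :- con (ι (+ 8)) :* (v₄ :* v₄ :* v₄) :- con (ι (+ 27)) :* (v₆ :* v₆)
            :+ con (ι (+ 9)) :* v₂ :* v₄ :* v₆
        := u :* u :* u :* u :* u :* u :* u :* u :* u :* u :* u :* u :*
           (:- (b₂ :* b₂ :* b₈) :- con (ι (+ 8)) :* (b₄ :* b₄ :* b₄) :- con (ι (+ 27)) :* (b₆ :* b₆)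
             :+ con (ι (+ 9)) :* b₂ :* b₄ :* b₆))
      refl u (b₂ E) (b₄ E) (b₆ E) (b₈ E))

  -- The roots of ψ₂² are the x-coordinates of the points of order 2.
  ψ₂² : Weierstrass → ℚ → ℚ
  ψ₂² E x = ι (+ 4) * x * x * x + b₂ E * x * x + ι (+ 2) * b₄ E * x + b₆ E

  -- On the curve ψ₂²(x) = (2y + a₁x + a₃)², and 2y + a₁x + a₃ is the difference of the ordinates of
  -- P and -P.
  order2⇒ψ₂²≡0 : ∀ a₁ a₂ a₃ a₄ a₆ x y →
    y * y + a₁ * x * y + a₃ * y ≡ x * x * x + a₂ * x * x + a₄ * x + a₆ →
    y ≡ - y - a₁ * x - a₃ → ψ₂² (mkW a₁ a₂ a₃ a₄ a₆) x ≡ 0ℚ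
  order2⇒ψ₂²≡0 a₁ a₂ a₃ a₄ a₆ x y onCurve neg = begin
    ψ₂² (mkW a₁ a₂ a₃ a₄ a₆) x
      ≡⟨ solve 6 (λ a₁ a₂ a₃ a₄ a₆ x →
          con (ι (+ 4)) :* x :* x :* x :+ (a₁ :* a₁ :+ con (ι (+ 4)) :* a₂) :* x :* x
            :+ con (ι (+ 2)) :* (con (ι (+ 2)) :* a₄ :+ a₁ :* a₃) :* x :+ (a₃ :* a₃ :+ con (ι (+ 4)) :* a₆)
          := con (ι (+ 4)) :* (x :* x :* x :+ a₂ :* x :* x :+ a₄ :* x :+ a₆)
             :+ (a₁ :* x :+ a₃) :* (a₁ :* x :+ a₃)) refl a₁ a₂ a₃ a₄ a₆ x ⟩
    ι (+ 4) * (x * x * x + a₂ * x * x + a₄ * x + a₆) + (a₁ * x + a₃) * (a₁ * x + a₃)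
      ≡⟨ cong (λ w → ι (+ 4) * w + (a₁ * x + a₃) * (a₁ * x + a₃)) (sym onCurve) ⟩
    ι (+ 4) * (y * y + a₁ * x * y + a₃ * y) + (a₁ * x + a₃) * (a₁ * x + a₃)
      ≡⟨ solve 4 (λ a₁ a₃ x y →
          con (ι (+ 4)) :* (y :* y :+ a₁ :* x :* y :+ a₃ :* y) :+ (a₁ :* x :+ a₃) :* (a₁ :* x :+ a₃)
          := (y :- (:- y :- a₁ :* x :- a₃)) :* (y :- (:- y :- a₁ :* x :- a₃))) refl a₁ a₃ x y ⟩
    (y - (- y - a₁ * x - a₃)) * (y - (- y - a₁ * x - a₃))
      ≡⟨ cong (λ w → (y - w) * (y - w)) (sym neg) ⟩
    (y - y) * (y - y)
      ≡⟨ solve 1 (λ y → (y :- y) :* (y :- y) := con 0ℚ) refl y ⟩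
    0ℚ ∎
    where open ≡-Reasoning

  -- Moving polynomial identities between ℤ and ℚ

  infixl 6 _⊕_ _⊖_
  infixl 7 _⊗_

  -- Ring expressions with one value in ℤ and one in ℚ. An atom may carry any rational known to
  -- equal the image of its integer, so `ι-⟦_⟧` pushes `ι` to the leaves and rewrites them at the
  -- same time.
  data Expr : Set where
    atom        : ∀ z x → ι z ≡ x → Expr
    _⊕_ _⊖_ _⊗_ : Expr → Expr → Expr
    ⊝_          : Expr → Expr

  K : ℤ → Expr
  K z = atom z (ι z) refl

  ⟦_⟧ℤ : Expr → ℤ
  ⟦ atom z x eq ⟧ℤ = z
  ⟦ e ⊕ f ⟧ℤ = ⟦ e ⟧ℤ ℤ.+ ⟦ f ⟧ℤ
  ⟦ e ⊖ f ⟧ℤ = ⟦ e ⟧ℤ ℤ.- ⟦ f ⟧ℤ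
  ⟦ e ⊗ f ⟧ℤ = ⟦ e ⟧ℤ ℤ.* ⟦ f ⟧ℤ
  ⟦ ⊝ e ⟧ℤ   = ℤ.- ⟦ e ⟧ℤ

  ⟦_⟧ℚ : Expr → ℚ
  ⟦ atom z x eq ⟧ℚ = x
  ⟦ e ⊕ f ⟧ℚ = ⟦ e ⟧ℚ + ⟦ f ⟧ℚ
  ⟦ e ⊖ f ⟧ℚ = ⟦ e ⟧ℚ - ⟦ f ⟧ℚ
  ⟦ e ⊗ f ⟧ℚ = ⟦ e ⟧ℚ * ⟦ f ⟧ℚ
  ⟦ ⊝ e ⟧ℚ   = - ⟦ e ⟧ℚ

  ι-⟦_⟧ : ∀ e → ι ⟦ e ⟧ℤ ≡ ⟦ e ⟧ℚ
  ι-⟦ atom z x eq ⟧ = eq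
  ι-⟦ e ⊕ f ⟧ = trans (ι-homo-+ ⟦ e ⟧ℤ ⟦ f ⟧ℤ) (cong₂ _+_ ι-⟦ e ⟧ ι-⟦ f ⟧)
  ι-⟦ e ⊖ f ⟧ = trans (ι-homo-- ⟦ e ⟧ℤ ⟦ f ⟧ℤ) (cong₂ _-_ ι-⟦ e ⟧ ι-⟦ f ⟧)
  ι-⟦ e ⊗ f ⟧ = trans (ι-homo-* ⟦ e ⟧ℤ ⟦ f ⟧ℤ) (cong₂ _*_ ι-⟦ e ⟧ ι-⟦ f ⟧)
  ι-⟦ ⊝ e ⟧   = trans (ι-homo‿- ⟦ e ⟧ℤ) (cong -_ ι-⟦ e ⟧)

  -- Cancellation in ℚ and integrality of rational roots

  *-cancelˡ-≢0 : ∀ {x y z} → x ≢ 0ℚ → x * y ≡ x * z → y ≡ z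
  *-cancelˡ-≢0 {x} {y} {z} x≢0 eq = begin
    y                ≡⟨ shift y ⟨
    1/x * (x * y)    ≡⟨ cong (1/x *_) eq ⟩
    1/x * (x * z)    ≡⟨ shift z ⟩
    z                ∎
    where
    open ≡-Reasoning
    instance
      nz : ℚ.NonZero x
      nz = ℚ.≢-nonZero x≢0
    1/x = ℚ.1/ x
    shift : ∀ w → 1/x * (x * w) ≡ w
    shift w = trans (sym (ℚₚ.*-assoc 1/x x w)) (trans (cong (_* w) (ℚₚ.*-inverseˡ x)) (ℚₚ.*-identityˡ w))

  *-≢0 : ∀ {x y} → x ≢ 0ℚ → y ≢ 0ℚ → x * y ≢ 0ℚ
  *-≢0 {x} x≢0 y≢0 eq = y≢0 (*-cancelˡ-≢0 x≢0 (trans eq (sym (ℚₚ.*-zeroʳ x))))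

  ι-≢0 : ∀ {z} → z ≢ + 0 → ι z ≢ 0ℚ
  ι-≢0 {z} z≢0 eq = z≢0 (ι-injective {z} {+ 0} eq)

  ↥-↧-coprime : ∀ r → Coprime ∣ ↥ r ∣ ∣ ↧ r ∣
  ↥-↧-coprime (mkℚ _ _ c) = Coprimality.recompute c

  monicCubicRoot-integral : ∀ b c d ξ →
    ξ * ξ * ξ + ι b * (ξ * ξ) + ι c * ξ + ι d ≡ 0ℚ → Σ ℤ λ X → ι X ≡ ξ
  monicCubicRoot-integral b c d ξ root = n , trans (sym mξ≡n) (trans (cong (λ t → ι t * ξ) m≡1) (ℚₚ.*-identityˡ ξ))
    where
    n = ↥ ξ
    m = ↧ ξ
    mξ≡n : ι m * ξ ≡ ι n
    mξ≡n = ↧*≡↥ ξ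
    k = b ℤ.* (n ℤ.* n) ℤ.+ c ℤ.* (n ℤ.* m) ℤ.+ d ℤ.* (m ℤ.* m)
    -- m³ times the equation satisfied by ξ = n / m.
    cleared : n ℤ.* (n ℤ.* n) ℤ.+ m ℤ.* k ≡ + 0
    cleared = ι-injective {n ℤ.* (n ℤ.* n) ℤ.+ m ℤ.* k} {+ 0} (begin
      ι (n ℤ.* (n ℤ.* n) ℤ.+ m ℤ.* k)
        ≡⟨ ι-⟦ N ⊗ (N ⊗ N) ⊕ K m ⊗ (K b ⊗ (N ⊗ N) ⊕ K c ⊗ (N ⊗ K m) ⊕ K d ⊗ (K m ⊗ K m)) ⟧ ⟩
      ι m * ξ * (ι m * ξ * (ι m * ξ))
        + ι m * (ι b * (ι m * ξ * (ι m * ξ)) + ι c * (ι m * ξ * ι m) + ι d * (ι m * ι m))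
        ≡⟨ solve 5 (λ m ξ b c d →
            m :* ξ :* (m :* ξ :* (m :* ξ))
              :+ m :* (b :* (m :* ξ :* (m :* ξ)) :+ c :* (m :* ξ :* m) :+ d :* (m :* m))
            := m :* m :* m :* (ξ :* ξ :* ξ :+ b :* (ξ :* ξ) :+ c :* ξ :+ d))
            refl (ι m) ξ (ι b) (ι c) (ι d) ⟩
      ι m * ι m * ι m * (ξ * ξ * ξ + ι b * (ξ * ξ) + ι c * ξ + ι d)
        ≡⟨ cong (ι m * ι m * ι m *_) root ⟩
      ι m * ι m * ι m * 0ℚ
        ≡⟨ ℚₚ.*-zeroʳ (ι m * ι m * ι m) ⟩
      0ℚ ∎)
      where
      open ≡-Reasoning
      N = atom n (ι m * ξ) (sym mξ≡n)
    m∣n³ : ∣ m ∣ ∣ ∣ n ∣ ℕ.* (∣ n ∣ ℕ.* ∣ n ∣)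
    m∣n³ = subst (∣ m ∣ ∣_) eq (ℕᵈ.m∣m*n ∣ k ∣)
      where
      n³≡-mk : n ℤ.* (n ℤ.* n) ≡ ℤ.- (m ℤ.* k)
      n³≡-mk = ℤₚ.i-j≡0⇒i≡j (n ℤ.* (n ℤ.* n)) (ℤ.- (m ℤ.* k))
        (trans (cong (λ t → n ℤ.* (n ℤ.* n) ℤ.+ t) (ℤₚ.neg-involutive (m ℤ.* k))) cleared)
      eq : ∣ m ∣ ℕ.* ∣ k ∣ ≡ ∣ n ∣ ℕ.* (∣ n ∣ ℕ.* ∣ n ∣)
      eq = trans (sym (ℤₚ.abs-* m k)) (trans (sym (ℤₚ.∣-i∣≡∣i∣ (m ℤ.* k))) (trans (cong ∣_∣ (sym n³≡-mk))
           (trans (ℤₚ.abs-* n (n ℤ.* n)) (cong (∣ n ∣ ℕ.*_) (ℤₚ.abs-* n n)))))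
    -- m divides n³ and is prime to n: two factors n are cancelled, and m ∣ n then forces m to be a
    -- unit.
    m∣1 : ∣ m ∣ ≡ 1
    m∣1 = ↥-↧-coprime ξ (coprime-divisor cop (coprime-divisor cop m∣n³) , ℕᵈ.∣-refl)
      where cop = Coprimality.sym (↥-↧-coprime ξ)
    m≡1 : m ≡ + 1
    m≡1 = cong +_ m∣1

  -- Clearing denominators at ℓ, and the integral pair of a local model

  toℚW : ℤWeierstrass → Weierstrass
  toℚW (mkℤW a₁ a₂ a₃ a₄ a₆) = mkW (ι a₁) (ι a₂) (ι a₃) (ι a₄) (ι a₆)

  b₂ᵉ b₄ᵉ b₆ᵉ b₈ᵉ c₄ᵉ Δᵉ : ℤWeierstrass → Expr
  b₂ᵉ (mkℤW a₁ a₂ a₃ a₄ a₆) = K a₁ ⊗ K a₁ ⊕ K (+ 4) ⊗ K a₂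
  b₄ᵉ (mkℤW a₁ a₂ a₃ a₄ a₆) = K (+ 2) ⊗ K a₄ ⊕ K a₁ ⊗ K a₃
  b₆ᵉ (mkℤW a₁ a₂ a₃ a₄ a₆) = K a₃ ⊗ K a₃ ⊕ K (+ 4) ⊗ K a₆
  b₈ᵉ (mkℤW a₁ a₂ a₃ a₄ a₆) = K a₁ ⊗ K a₁ ⊗ K a₆ ⊕ K (+ 4) ⊗ K a₂ ⊗ K a₆ ⊖ K a₁ ⊗ K a₃ ⊗ K a₄
    ⊕ K a₂ ⊗ K a₃ ⊗ K a₃ ⊖ K a₄ ⊗ K a₄
  c₄ᵉ M = b₂ᵉ M ⊗ b₂ᵉ M ⊖ K (+ 24) ⊗ b₄ᵉ M
  Δᵉ M = ⊝ (b₂ᵉ M ⊗ b₂ᵉ M ⊗ b₈ᵉ M) ⊖ K (+ 8) ⊗ (b₄ᵉ M ⊗ b₄ᵉ M ⊗ b₄ᵉ M) ⊖ K (+ 27) ⊗ (b₆ᵉ M ⊗ b₆ᵉ M)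
    ⊕ K (+ 9) ⊗ b₂ᵉ M ⊗ b₄ᵉ M ⊗ b₆ᵉ M

  mkW-cong : ∀ {a₁ a₂ a₃ a₄ a₆ a₁′ a₂′ a₃′ a₄′ a₆′} →
    a₁ ≡ a₁′ → a₂ ≡ a₂′ → a₃ ≡ a₃′ → a₄ ≡ a₄′ → a₆ ≡ a₆′ →
    mkW a₁ a₂ a₃ a₄ a₆ ≡ mkW a₁′ a₂′ a₃′ a₄′ a₆′
  mkW-cong refl refl refl refl refl = refl

  scale-scale : ∀ v u E → scale v (scale u E) ≡ scale (v * u) E
  scale-scale v u (mkW a₁ a₂ a₃ a₄ a₆) = mkW-cong
    (solve 3 (λ v u a → v :* (u :* a) := (v :* u) :* a) refl v u a₁)
    (solve 3 (λ v u a → v :* v :* (u :* u :* a) := (v :* u) :* (v :* u) :* a) refl v u a₂)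
    (solve 3 (λ v u a → v :* v :* v :* (u :* u :* u :* a) := (v :* u) :* (v :* u) :* (v :* u) :* a) refl v u a₃)
    (solve 3 (λ v u a → v :* v :* v :* v :* (u :* u :* u :* u :* a)
      := (v :* u) :* (v :* u) :* (v :* u) :* (v :* u) :* a) refl v u a₄)
    (solve 3 (λ v u a → v :* v :* v :* v :* v :* v :* (u :* u :* u :* u :* u :* u :* a)
      := (v :* u) :* (v :* u) :* (v :* u) :* (v :* u) :* (v :* u) :* (v :* u) :* a) refl v u a₆)

  ∤-* : ∀ {ℓ} x y → Prime ℓ → ¬ ℓ ∣ ∣ x ∣ → ¬ ℓ ∣ ∣ y ∣ → ¬ ℓ ∣ ∣ x ℤ.* y ∣
  ∤-* {ℓ} x y pr ∤x ∤y ∣xy = [ ∤x , ∤y ]′ (euclidsLemma ∣ x ∣ ∣ y ∣ pr (subst (ℓ ∣_) (ℤₚ.abs-* x y) ∣xy))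

  ∣-*ˡ : ∀ {ℓ} x y → ℓ ∣ ∣ x ∣ → ℓ ∣ ∣ x ℤ.* y ∣
  ∣-*ˡ {ℓ} x y ∣x = subst (ℓ ∣_) (sym (ℤₚ.abs-* x y)) (ℕᵈ.∣m⇒∣m*n ∣ y ∣ ∣x)

  ∣-*ʳ : ∀ {ℓ} x y → ℓ ∣ ∣ y ∣ → ℓ ∣ ∣ x ℤ.* y ∣
  ∣-*ʳ {ℓ} x y ∣y = subst (ℓ ∣_) (sym (ℤₚ.abs-* x y)) (ℕᵈ.∣n⇒∣m*n ∣ x ∣ ∣y)

  HasDenominator : ℚ → ℤ → Set
  HasDenominator r D = Σ ℤ λ z → ι z ≡ ι D * r

  hasDenominator-↧ : ∀ r D → HasDenominator r (D ℤ.* ↧ r)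
  hasDenominator-↧ r D = D ℤ.* ↥ r , (begin
    ι (D ℤ.* ↥ r)        ≡⟨ ι-homo-* D (↥ r) ⟩
    ι D * ι (↥ r)        ≡⟨ cong (ι D *_) (↧*≡↥ r) ⟨
    ι D * (ι (↧ r) * r)  ≡⟨ ℚₚ.*-assoc (ι D) (ι (↧ r)) r ⟨
    ι D * ι (↧ r) * r    ≡⟨ cong (_* r) (ι-homo-* D (↧ r)) ⟨
    ι (D ℤ.* ↧ r) * r    ∎)
    where open ≡-Reasoning

  hasDenominator-* : ∀ r D C → HasDenominator r D → HasDenominator r (D ℤ.* C)
  hasDenominator-* r D C (z , eq) = z ℤ.* C , (begin
    ι (z ℤ.* C)          ≡⟨ ι-homo-* z C ⟩
    ι z * ι C            ≡⟨ cong (_* ι C) eq ⟩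
    ι D * r * ι C        ≡⟨ solve 3 (λ D r C → D :* r :* C := D :* C :* r) refl (ι D) r (ι C) ⟩
    ι D * ι C * r        ≡⟨ cong (_* r) (ι-homo-* D C) ⟨
    ι (D ℤ.* C) * r      ∎)
    where open ≡-Reasoning

  -- Scaling by D multiplies aᵢ by Dⁱ with i ≥ 1: one factor D absorbs the denominator and the
  -- others keep the result integral.
  integralScaling : ∀ {a₁ a₂ a₃ a₄ a₆} D →
    HasDenominator a₁ D → HasDenominator a₂ D → HasDenominator a₃ D → HasDenominator a₄ D → HasDenominator a₆ D →
    Σ ℤWeierstrass λ M → toℚW M ≡ scale (ι D) (mkW a₁ a₂ a₃ a₄ a₆)
  integralScaling {a₁} {a₂} {a₃} {a₄} {a₆} D (z₁ , e₁) (z₂ , e₂) (z₃ , e₃) (z₄ , e₄) (z₆ , e₆) =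
    mkℤW z₁ (D ℤ.* z₂) (D ℤ.* D ℤ.* z₃) (D ℤ.* D ℤ.* D ℤ.* z₄) (D ℤ.* D ℤ.* D ℤ.* D ℤ.* D ℤ.* z₆)
    , mkW-cong
       e₁
       (trans ι-⟦ K D ⊗ atom z₂ (ι D * a₂) e₂ ⟧
         (solve 2 (λ D a → D :* (D :* a) := D :* D :* a) refl (ι D) a₂))
       (trans ι-⟦ K D ⊗ K D ⊗ atom z₃ (ι D * a₃) e₃ ⟧
         (solve 2 (λ D a → D :* D :* (D :* a) := D :* D :* D :* a) refl (ι D) a₃))
       (trans ι-⟦ K D ⊗ K D ⊗ K D ⊗ atom z₄ (ι D * a₄) e₄ ⟧
         (solve 2 (λ D a → D :* D :* D :* (D :* a) := D :* D :* D :* D :* a) refl (ι D) a₄))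
       (trans ι-⟦ K D ⊗ K D ⊗ K D ⊗ K D ⊗ K D ⊗ atom z₆ (ι D * a₆) e₆ ⟧
         (solve 2 (λ D a → D :* D :* D :* D :* D :* (D :* a) := D :* D :* D :* D :* D :* D :* a) refl (ι D) a₆))

  commonDenominator : ∀ {ℓ} → Prime ℓ → ∀ {rs} → All (IntegralAt ℓ) rs →
    Σ ℤ λ D → ¬ ℓ ∣ ∣ D ∣ × All (λ r → HasDenominator r D) rs
  commonDenominator pr [] = + 1 , (λ h → ¬prime[1] (subst Prime (ℕᵈ.∣1⇒≡1 h) pr)) , []
  commonDenominator pr {r ∷ _} (∤↧r ∷ ints) =
    let D , ∤D , hs = commonDenominator pr ints
    in D ℤ.* ↧ r , ∤-* D (↧ r) pr ∤D ∤↧r , hasDenominator-↧ r D ∷ All.map (λ {s} → hasDenominator-* s D (↧ r)) hs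

  clearDenominators : ∀ {ℓ} → Prime ℓ → ∀ W → IntegralModelAt ℓ W →
    Σ ℤ λ D → ¬ ℓ ∣ ∣ D ∣ × Σ ℤWeierstrass λ M → toℚW M ≡ scale (ι D) W
  clearDenominators {ℓ} pr (mkW a₁ a₂ a₃ a₄ a₆) (i₁ , i₂ , i₃ , i₄ , i₆) =
    finish (commonDenominator pr (i₁ ∷ i₂ ∷ i₃ ∷ i₄ ∷ i₆ ∷ []))
    where
    finish : (Σ ℤ λ D → ¬ ℓ ∣ ∣ D ∣ × All (λ r → HasDenominator r D) (a₁ ∷ a₂ ∷ a₃ ∷ a₄ ∷ a₆ ∷ [])) →
      Σ ℤ λ D → ¬ ℓ ∣ ∣ D ∣ × Σ ℤWeierstrass λ M → toℚW M ≡ scale (ι D) (mkW a₁ a₂ a₃ a₄ a₆)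
    finish (D , ∤D , h₁ ∷ h₂ ∷ h₃ ∷ h₄ ∷ h₆ ∷ []) =
      D , ∤D , integralScaling {a₁} {a₂} {a₃} {a₄} {a₆} D h₁ h₂ h₃ h₄ h₆

  -- Everything comes from z · ↧r = D · ↥r, where ℓ ∤ D. If ℓ divides ↥r, then it cannot divide ↧r,
  -- since the fraction is in lowest terms.
  ∣-↥⇔ : ∀ {ℓ} → Prime ℓ → ∀ D z r → ¬ ℓ ∣ ∣ D ∣ → ι z ≡ ι D * r →
    (DividesAt ℓ r → ℓ ∣ ∣ z ∣) × (ℓ ∣ ∣ z ∣ → DividesAt ℓ r)
  ∣-↥⇔ {ℓ} pr D z r ∤D eq = to , from
    where
    zm≡Dn : z ℤ.* ↧ r ≡ D ℤ.* ↥ r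
    zm≡Dn = ι-injective {z ℤ.* ↧ r} {D ℤ.* ↥ r} (begin
      ι (z ℤ.* ↧ r)        ≡⟨ ι-⟦ atom z (ι D * r) eq ⊗ K (↧ r) ⟧ ⟩
      ι D * r * ι (↧ r)    ≡⟨ solve 3 (λ D r m → D :* r :* m := D :* (m :* r)) refl (ι D) r (ι (↧ r)) ⟩
      ι D * (ι (↧ r) * r)  ≡⟨ cong (ι D *_) (↧*≡↥ r) ⟩
      ι D * ι (↥ r)        ≡⟨ ι-homo-* D (↥ r) ⟨
      ι (D ℤ.* ↥ r)        ∎)
      where open ≡-Reasoning
    to : DividesAt ℓ r → ℓ ∣ ∣ z ∣
    to ∣n = [ id , (λ ∣m → contradiction (subst Prime (↥-↧-coprime r (∣n , ∣m)) pr) ¬prime[1]) ]′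
      (euclidsLemma ∣ z ∣ ∣ ↧ r ∣ pr (subst (ℓ ∣_) (trans (cong ∣_∣ (sym zm≡Dn)) (ℤₚ.abs-* z (↧ r))) (∣-*ʳ D (↥ r) ∣n)))
    from : ℓ ∣ ∣ z ∣ → DividesAt ℓ r
    from ∣z = [ (λ ∣D → contradiction ∣D ∤D) , id ]′
      (euclidsLemma ∣ D ∣ ∣ ↥ r ∣ pr (subst (ℓ ∣_) (trans (cong ∣_∣ zm≡Dn) (ℤₚ.abs-* D (↥ r))) (∣-*ˡ z (↧ r) ∣z)))

  -- The powers of u stand on the side of W in `Isomorphic`, so it says that E translated is W
  -- scaled, with no division by u.
  Isomorphic⇒translate≡scale : ∀ E W → ((u , r , s , t , _) : Isomorphic E W) → translate E r s t ≡ scale u W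
  Isomorphic⇒translate≡scale E W (u , r , s , t , _ , e₁ , e₂ , e₃ , e₄ , e₆) =
    mkW-cong (sym e₁) (sym e₂) (sym e₃) (sym e₄) (sym e₆)

  -- M is W with denominators cleared by some D prime to ℓ.  With (u , r , s , t) the isomorphism from E to W,
  -- v = D / u and X = 4v²(x - r).
  record IntegralModel (E : Weierstrass) (x : ℚ) (ℓ : ℕ) (W : Weierstrass) : Set where
    field
      M      : ℤWeierstrass
      X      : ℤ
      v      : ℚ
      v≢0    : v ≢ 0ℚ
      root   : cubic M X ≡ + 0
      ι-A    : ι (A M X) ≡ v * v * (b₂ E + ι (+ 12) * x)
      ι-B    : ι (B M X) ≡ v * v * (v * v) * (ι (+ 48) * x * x + ι (+ 8) * b₂ E * x + ι (+ 8) * b₄ E)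
      ∣Δ⇒    : DividesAt ℓ (Δ W) → ℓ ∣ ∣ Δᶻ M ∣
      ∣Δ⇐    : ℓ ∣ ∣ Δᶻ M ∣ → DividesAt ℓ (Δ W)
      ∣c₄⇐   : ℓ ∣ ∣ c₄ᶻ M ∣ → DividesAt ℓ (c₄ W)

    a b : ℤ
    a = A M X
    b = B M X

  scaledModel : ∀ E x {ℓ} W → Prime ℓ → Isomorphic E W → ψ₂² E x ≡ 0ℚ →
    ∀ D M → ¬ ℓ ∣ ∣ D ∣ → toℚW M ≡ scale (ι D) W → IntegralModel E x ℓ W
  scaledModel E x {ℓ} W pr iso@(u , r , s , t , u≢0 , _) ψ≡0 D M ∤D M≡ = record
    { M = M ; X = X ; v = v ; v≢0 = v≢0
    ; root = ι-injective {cubic M X} {+ 0} (trans ι-cubic cubic≡0)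
    ; ι-A = trans ι-⟦ b₂ᵉ M ⊕ K (+ 3) ⊗ Xᵉ ⟧ (trans (cong (_+ ι (+ 3) * ξ) β₂)
        (solve 4 (λ v b₂ r x → v :* v :* (b₂ :+ con (ι (+ 12)) :* r) :+ con (ι (+ 3)) :* (con (ι (+ 4)) :* (v :* v) :* (x :- r))
          := v :* v :* (b₂ :+ con (ι (+ 12)) :* x)) refl v (b₂ E) r x))
    ; ι-B = trans ι-⟦ K (+ 3) ⊗ (Xᵉ ⊗ Xᵉ) ⊕ K (+ 2) ⊗ b₂ᵉ M ⊗ Xᵉ ⊕ K (+ 8) ⊗ b₄ᵉ M ⟧
        (trans (cong₂ (λ y z → ι (+ 3) * (ξ * ξ) + ι (+ 2) * y * ξ + ι (+ 8) * z) β₂ β₄)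
         (solve 5 (λ v b₂ b₄ r x → let ξ = con (ι (+ 4)) :* (v :* v) :* (x :- r) in
            con (ι (+ 3)) :* (ξ :* ξ) :+ con (ι (+ 2)) :* (v :* v :* (b₂ :+ con (ι (+ 12)) :* r)) :* ξ
              :+ con (ι (+ 8)) :* (v :* v :* v :* v :* (b₄ :+ r :* b₂ :+ con (ι (+ 6)) :* r :* r))
            := v :* v :* (v :* v) :* (con (ι (+ 48)) :* x :* x :+ con (ι (+ 8)) :* b₂ :* x :+ con (ι (+ 8)) :* b₄))
           refl v (b₂ E) (b₄ E) r x))
    ; ∣Δ⇒ = proj₁ Δ⇔
    ; ∣Δ⇐ = proj₂ Δ⇔
    ; ∣c₄⇐ = proj₂ (∣-↥⇔ pr D⁴ (c₄ᶻ M) (c₄ W) ∤D⁴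
        (trans ι-⟦ c₄ᵉ M ⟧ (trans (cong c₄ M≡) (trans (c₄-scale (ι D) W)
          (cong (_* c₄ W) (sym ι-⟦ K D ⊗ K D ⊗ K D ⊗ K D ⟧))))))
    }
    where
    instance
      nz : ℚ.NonZero u
      nz = ℚ.≢-nonZero u≢0
    v = ι D * ℚ.1/ u
    vu≡D : v * u ≡ ι D
    vu≡D = trans (ℚₚ.*-assoc (ι D) (ℚ.1/ u) u) (trans (cong (ι D *_) (ℚₚ.*-inverseˡ u)) (ℚₚ.*-identityʳ (ι D)))
    v≢0 : v ≢ 0ℚ
    v≢0 v≡0 = ι-≢0 {D} (λ { refl → ∤D (ℕᵈ._∣0 ℓ) }) (trans (sym vu≡D) (trans (cong (_* u) v≡0) (ℚₚ.*-zeroˡ u)))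
    T = translate E r s t
    M≡T : toℚW M ≡ scale v T
    M≡T = trans M≡ (trans (cong (λ d → scale d W) (sym vu≡D))
      (trans (sym (scale-scale v u W)) (cong (scale v) (sym (Isomorphic⇒translate≡scale E W iso)))))
    β₂ : b₂ (toℚW M) ≡ v * v * (b₂ E + ι (+ 12) * r)
    β₂ = trans (cong b₂ M≡T) (trans (b₂-scale v T) (cong (v * v *_) (b₂-translate E r s t)))
    β₄ : b₄ (toℚW M) ≡ v * v * v * v * (b₄ E + r * b₂ E + ι (+ 6) * r * r)
    β₄ = trans (cong b₄ M≡T) (trans (b₄-scale v T) (cong (v * v * v * v *_) (b₄-translate E r s t)))
    β₆ : b₆ (toℚW M) ≡ v * v * v * v * v * v * (b₆ E + ι (+ 2) * r * b₄ E + r * r * b₂ E + ι (+ 4) * r * r * r)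
    β₆ = trans (cong b₆ M≡T) (trans (b₆-scale v T) (cong (v * v * v * v * v * v *_) (b₆-translate E r s t)))
    -- v²(x - r) is the abscissa of the point on M. The factor 4 turns the division polynomial, with
    -- leading coefficient 4, into the monic `cubic`.
    ξ = ι (+ 4) * (v * v) * (x - r)
    cubic≡0 : ξ * ξ * ξ + b₂ (toℚW M) * (ξ * ξ) + ι (+ 8) * b₄ (toℚW M) * ξ + ι (+ 16) * b₆ (toℚW M) ≡ 0ℚ
    cubic≡0 = begin
      ξ * ξ * ξ + b₂ (toℚW M) * (ξ * ξ) + ι (+ 8) * b₄ (toℚW M) * ξ + ι (+ 16) * b₆ (toℚW M)
        ≡⟨ cong₂ (λ y z → ξ * ξ * ξ + y * (ξ * ξ) + ι (+ 8) * z * ξ + ι (+ 16) * b₆ (toℚW M)) β₂ β₄ ⟩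
      ξ * ξ * ξ + v * v * (b₂ E + ι (+ 12) * r) * (ξ * ξ) + ι (+ 8) * (v * v * v * v * (b₄ E + r * b₂ E + ι (+ 6) * r * r)) * ξ
        + ι (+ 16) * b₆ (toℚW M)
        ≡⟨ cong (λ z → ξ * ξ * ξ + v * v * (b₂ E + ι (+ 12) * r) * (ξ * ξ)
             + ι (+ 8) * (v * v * v * v * (b₄ E + r * b₂ E + ι (+ 6) * r * r)) * ξ + ι (+ 16) * z) β₆ ⟩
      _ ≡⟨ solve 6 (λ v b₂ b₄ b₆ r x → let ξ = con (ι (+ 4)) :* (v :* v) :* (x :- r) in
            ξ :* ξ :* ξ :+ v :* v :* (b₂ :+ con (ι (+ 12)) :* r) :* (ξ :* ξ)
              :+ con (ι (+ 8)) :* (v :* v :* v :* v :* (b₄ :+ r :* b₂ :+ con (ι (+ 6)) :* r :* r)) :* ξ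
              :+ con (ι (+ 16)) :* (v :* v :* v :* v :* v :* v :*
                 (b₆ :+ con (ι (+ 2)) :* r :* b₄ :+ r :* r :* b₂ :+ con (ι (+ 4)) :* r :* r :* r))
            := con (ι (+ 16)) :* (v :* v :* v :* v :* v :* v) :*
               (con (ι (+ 4)) :* x :* x :* x :+ b₂ :* x :* x :+ con (ι (+ 2)) :* b₄ :* x :+ b₆))
            refl v (b₂ E) (b₄ E) (b₆ E) r x ⟩
      ι (+ 16) * (v * v * v * v * v * v) * ψ₂² E x
        ≡⟨ cong (ι (+ 16) * (v * v * v * v * v * v) *_) ψ≡0 ⟩
      ι (+ 16) * (v * v * v * v * v * v) * 0ℚ
        ≡⟨ ℚₚ.*-zeroʳ (ι (+ 16) * (v * v * v * v * v * v)) ⟩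
      0ℚ ∎
      where open ≡-Reasoning
    X∃ = monicCubicRoot-integral (b₂ᶻ M) (+ 8 ℤ.* b₄ᶻ M) (+ 16 ℤ.* b₆ᶻ M) ξ
      (trans (cong₂ _+_ (cong₂ _+_ (cong (λ y → ξ * ξ * ξ + y * (ξ * ξ)) ι-⟦ b₂ᵉ M ⟧)
                                   (cong (_* ξ) ι-⟦ K (+ 8) ⊗ b₄ᵉ M ⟧))
                        ι-⟦ K (+ 16) ⊗ b₆ᵉ M ⟧) cubic≡0)
    X = proj₁ X∃
    Xᵉ = atom X ξ (proj₂ X∃)
    ι-cubic : ι (cubic M X) ≡ ξ * ξ * ξ + b₂ (toℚW M) * (ξ * ξ) + ι (+ 8) * b₄ (toℚW M) * ξ + ι (+ 16) * b₆ (toℚW M)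
    ι-cubic = ι-⟦ Xᵉ ⊗ Xᵉ ⊗ Xᵉ ⊕ b₂ᵉ M ⊗ (Xᵉ ⊗ Xᵉ) ⊕ K (+ 8) ⊗ b₄ᵉ M ⊗ Xᵉ ⊕ K (+ 16) ⊗ b₆ᵉ M ⟧
    D⁴ = D ℤ.* D ℤ.* D ℤ.* D
    ∤D⁴ : ¬ ℓ ∣ ∣ D⁴ ∣
    ∤D⁴ = ∤-* (D ℤ.* D ℤ.* D) D pr (∤-* (D ℤ.* D) D pr (∤-* D D pr ∤D ∤D) ∤D) ∤D
    ∤D⁸ : ¬ ℓ ∣ ∣ D⁴ ℤ.* D⁴ ∣
    ∤D⁸ = ∤-* D⁴ D⁴ pr ∤D⁴ ∤D⁴
    ∤D¹² : ¬ ℓ ∣ ∣ D⁴ ℤ.* D⁴ ℤ.* D⁴ ∣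
    ∤D¹² = ∤-* (D⁴ ℤ.* D⁴) D⁴ pr ∤D⁸ ∤D⁴
    D⁴ᵉ = K D ⊗ K D ⊗ K D ⊗ K D
    Δ⇔ = ∣-↥⇔ pr (D⁴ ℤ.* D⁴ ℤ.* D⁴) (Δᶻ M) (Δ W) ∤D¹²
       (trans ι-⟦ Δᵉ M ⟧ (trans (cong Δ M≡) (trans (Δ-scale (ι D) W) (cong (_* Δ W)
         (trans (solve 1 (λ D → let D⁴ = D :* D :* D :* D in
              D :* D :* D :* D :* D :* D :* D :* D :* D :* D :* D :* D := D⁴ :* D⁴ :* D⁴) refl (ι D))
           (sym ι-⟦ D⁴ᵉ ⊗ D⁴ᵉ ⊗ D⁴ᵉ ⟧))))))

  integralModel : ∀ E x {ℓ} W → Prime ℓ → Isomorphic E W → IntegralModelAt ℓ W → ψ₂² E x ≡ 0ℚ → IntegralModel E x ℓ W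
  integralModel E x W pr iso int ψ≡0 =
    let D , ∤D , M , M≡ = clearDenominators pr W int
    in scaledModel E x W pr iso ψ≡0 D M ∤D M≡

module _ where

  open import Data.Integer using (_+_; _*_; _-_; -_; _^_) renaming (∣_∣ to abs)
  import Data.Integer.DivMod as ℤᵈ
  open import Data.Integer.Divisibility.Signed
  open import Data.Integer.Tactic.RingSolver using (solve-∀)
  open import Data.Nat.Induction using (<-wellFounded)
  open import Data.Nat.ListAction using (product)
  open import Data.Nat.ListAction.Properties using (∈⇒∣product)
  open import Data.Nat.Primality.Factorisation using (factorise; module PrimeFactorisation)
  open import Data.Sign as Sign using (Sign; opposite)
  open import Function.Bundles using (_⇔_; mk⇔; module Equivalence)
  open import Induction.WellFounded using (Acc; acc)
  open import Relation.Nullary.Decidable using (from-yes; from-no; _×-dec_; toSum)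
  open Equivalence using (to; from)

  euclid : ∀ {ℓ} x y → Prime ℓ → + ℓ ∣ x * y → + ℓ ∣ x ⊎ + ℓ ∣ y
  euclid {ℓ} x y pr ∣xy with euclidsLemma (abs x) (abs y) pr (subst (Data.Nat.Divisibility._∣_ ℓ) (ℤₚ.abs-* x y) (∣⇒∣ᵤ ∣xy))
    where import Data.Nat.Divisibility
  ... | inj₁ h = inj₁ (∣ᵤ⇒∣ h)
  ... | inj₂ h = inj₂ (∣ᵤ⇒∣ h)

  -- The invariants in terms of a root of the cubic

  4b₈≡ : ∀ a₁ a₂ a₃ a₄ a₆ →
    + 4 * (a₁ * a₁ * a₆ + + 4 * a₂ * a₆ - a₁ * a₃ * a₄ + a₂ * a₃ * a₃ - a₄ * a₄)
    ≡ (a₁ * a₁ + + 4 * a₂) * (a₃ * a₃ + + 4 * a₆) - (+ 2 * a₄ + a₁ * a₃) * (+ 2 * a₄ + a₁ * a₃)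
  4b₈≡ = solve-∀

  -- With the factor 256, b₈ occurs only as 4b₈ and b₆ only as 16b₆. The former is b₂b₆ - b₄², and
  -- the latter is the constant term of the cubic, which a root X expresses through b₂, b₄ and X.
  256Δ≡ : ∀ b₂ b₄ b₆ b₈ →
    + 256 * (- (b₂ * b₂ * b₈) - + 8 * (b₄ * b₄ * b₄) - + 27 * (b₆ * b₆) + + 9 * b₂ * b₄ * b₆)
    ≡ - (+ 64 * (b₂ * b₂) * (+ 4 * b₈))
        - + 2048 * (b₄ * b₄ * b₄) - + 27 * (+ 16 * b₆ * (+ 16 * b₆)) + + 144 * b₂ * b₄ * (+ 16 * b₆)
  256Δ≡ = solve-∀

  256Δ≡′ : ∀ b₂ b₄ b₆ →
      - (+ 64 * (b₂ * b₂) * (b₂ * b₆ - b₄ * b₄))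
        - + 2048 * (b₄ * b₄ * b₄) - + 27 * (+ 16 * b₆ * (+ 16 * b₆)) + + 144 * b₂ * b₄ * (+ 16 * b₆)
    ≡ - (+ 4 * (b₂ * b₂) * (b₂ * (+ 16 * b₆) - + 16 * (b₄ * b₄)))
        - + 2048 * (b₄ * b₄ * b₄) - + 27 * (+ 16 * b₆ * (+ 16 * b₆)) + + 144 * b₂ * b₄ * (+ 16 * b₆)
  256Δ≡′ = solve-∀

  disc-root : ∀ b₂ b₄ X → let t = - (X * X * X + b₂ * (X * X) + + 8 * b₄ * X)
                              a = b₂ + + 3 * X
                              b = + 3 * (X * X) + + 2 * b₂ * X + + 8 * b₄ in
      - (+ 4 * (b₂ * b₂) * (b₂ * t - + 16 * (b₄ * b₄))) - + 2048 * (b₄ * b₄ * b₄) - + 27 * (t * t) + + 144 * b₂ * b₄ * t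
    ≡ b * b * (a * a - + 4 * b)
  disc-root = solve-∀

  x+y≡0⇒y≡-x : ∀ x y → x + y ≡ + 0 → y ≡ - x
  x+y≡0⇒y≡-x x y eq = ℤₚ.i-j≡0⇒i≡j y (- x) (trans (cong (λ t → y + t) (ℤₚ.neg-involutive x)) (trans (ℤₚ.+-comm y x) eq))

  discriminantAtRoot : ∀ M X → cubic M X ≡ + 0 → B M X * B M X * (A M X * A M X - + 4 * B M X) ≡ + 256 * Δᶻ M
  discriminantAtRoot M@(mkℤW a₁ a₂ a₃ a₄ a₆) X root = sym (begin
    + 256 * Δᶻ M
      ≡⟨ 256Δ≡ (b₂ᶻ M) (b₄ᶻ M) (b₆ᶻ M) (b₈ᶻ M) ⟩
    _ ≡⟨ cong (λ w → - (+ 64 * (b₂ᶻ M * b₂ᶻ M) * w) - + 2048 * (b₄ᶻ M * b₄ᶻ M * b₄ᶻ M) - + 27 * (+ 16 * b₆ᶻ M * (+ 16 * b₆ᶻ M))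
             + + 144 * b₂ᶻ M * b₄ᶻ M * (+ 16 * b₆ᶻ M)) (4b₈≡ a₁ a₂ a₃ a₄ a₆) ⟩
    _ ≡⟨ 256Δ≡′ (b₂ᶻ M) (b₄ᶻ M) (b₆ᶻ M) ⟩
    _ ≡⟨ cong (λ t → - (+ 4 * (b₂ᶻ M * b₂ᶻ M) * (b₂ᶻ M * t - + 16 * (b₄ᶻ M * b₄ᶻ M))) - + 2048 * (b₄ᶻ M * b₄ᶻ M * b₄ᶻ M)
                - + 27 * (t * t) + + 144 * b₂ᶻ M * b₄ᶻ M * t)
           (x+y≡0⇒y≡-x (X * X * X + b₂ᶻ M * (X * X) + + 8 * b₄ᶻ M * X) (+ 16 * b₆ᶻ M) root) ⟩
    _ ≡⟨ disc-root (b₂ᶻ M) (b₄ᶻ M) X ⟩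
    B M X * B M X * (A M X * A M X - + 4 * B M X) ∎)
    where open ≡-Reasoning

  c₄≡ : ∀ M X → c₄ᶻ M ≡ A M X * A M X - + 3 * B M X
  c₄≡ M X = identity (b₂ᶻ M) (b₄ᶻ M) X
    where
    identity : ∀ b₂ b₄ X → b₂ * b₂ - + 24 * b₄ ≡
      (b₂ + + 3 * X) * (b₂ + + 3 * X) - + 3 * (+ 3 * (X * X) + + 2 * b₂ * X + + 8 * b₄)
    identity = solve-∀

  -- Divisibility by powers of a prime

  primePower-cancel : ∀ {ℓ} → Prime ℓ → ∀ k {m} y → ¬ + ℓ ∣ m → + (ℓ ℕ.^ k) ∣ m * y → + (ℓ ℕ.^ k) ∣ y
  primePower-cancel pr zero y ∤m h = divides y (sym (ℤₚ.*-identityʳ y))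
  primePower-cancel {ℓ} pr (suc k) {m} y ∤m (divides q eq)
    with euclid m y pr (subst (+ ℓ ∣_) (sym (trans eq (cong (q *_) (ℤₚ.pos-* ℓ (ℓ ℕ.^ k)))))
      (∣n⇒∣m*n q (∣m⇒∣m*n (+ (ℓ ℕ.^ k)) ∣-refl)))
  ... | inj₁ ∣m = contradiction ∣m ∤m
  ... | inj₂ (divides y′ refl)
    with primePower-cancel pr k y′ ∤m (divides q (ℤₚ.*-cancelˡ-≡ (+ ℓ) (m * y′) (q * + (ℓ ℕ.^ k)) (begin
          + ℓ * (m * y′)         ≡⟨ lemma₁ (+ ℓ) m y′ ⟩
          m * (y′ * + ℓ)         ≡⟨ eq ⟩
          q * + (ℓ ℕ.* ℓ ℕ.^ k)    ≡⟨ cong (q *_) (ℤₚ.pos-* ℓ (ℓ ℕ.^ k)) ⟩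
          q * (+ ℓ * + (ℓ ℕ.^ k))  ≡⟨ lemma₂ (+ ℓ) q (+ (ℓ ℕ.^ k)) ⟩
          + ℓ * (q * + (ℓ ℕ.^ k))  ∎)))
    where
    open ≡-Reasoning
    instance
      nz : ℕ.NonZero ℓ
      nz = prime⇒nonZero pr
    lemma₁ : ∀ l m y → l * (m * y) ≡ m * (y * l)
    lemma₁ = solve-∀
    lemma₂ : ∀ l q r → q * (l * r) ≡ l * (q * r)
    lemma₂ = solve-∀
  ... | divides q′ refl = divides q′ (trans (lemma₃ q′ (+ (ℓ ℕ.^ k)) (+ ℓ)) (cong (q′ *_) (sym (ℤₚ.pos-* ℓ (ℓ ℕ.^ k)))))
    where
    lemma₃ : ∀ q r l → q * r * l ≡ q * (l * r)
    lemma₃ = solve-∀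

  ∣square⇒∣ : ∀ {ℓ} → Prime ℓ → ∀ x → + ℓ ∣ x * x → + ℓ ∣ x
  ∣square⇒∣ pr x h = [ id , id ]′ (euclid x x pr h)

  ∣cube⇒∣ : ∀ {ℓ} → Prime ℓ → ∀ x → + ℓ ∣ x * x * x → + ℓ ∣ x
  ∣cube⇒∣ pr x h = [ ∣square⇒∣ pr x , id ]′ (euclid (x * x) x pr h)

  _∣0 : ∀ k → k ∣ + 0
  k ∣0 = divides (+ 0) (sym (ℤₚ.*-zeroˡ k))

  k≡0⇒∣ : ∀ {k z} → z ≡ + 0 → k ∣ z
  k≡0⇒∣ {k} refl = k ∣0

  -- Good reduction at 2

  x+2y≡0⇒2∣x : ∀ x y → x + + 2 * y ≡ + 0 → + 2 ∣ x
  x+2y≡0⇒2∣x x y eq = ∣m+n∣n⇒∣m (k≡0⇒∣ eq) (∣m⇒∣m*n y ∣-refl)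

  2∣4 : + 2 ∣ + 4
  2∣4 = divides (+ 2) refl

  2∣8 : + 2 ∣ + 8
  2∣8 = divides (+ 4) refl

  2∤3 : ¬ + 2 ∣ + 3
  2∤3 = from-no (+ 2 ∣? + 3)

  -- The two alternatives are exchanged, up to scaling, by the 2-isogeny (a , b) ↦ (-2a , a² - 4b).
  TwoAdicShape : ℤ → ℤ → Set
  TwoAdicShape a b = (¬ + 2 ∣ a × + 16 ∣ b × ¬ + 32 ∣ b)
                ⊎ (¬ + 2 ∣ b × + 256 ∣ a * a - + 4 * b × ¬ + 512 ∣ a * a - + 4 * b)

  -- This is `cubic` with b₂ = 4k and b₄ = 2m, as for even a₁. If b₆ were odd, its 2-adic Newton
  -- polygon would be a single segment giving every root the valuation 4/3. The proof performs this
  -- as a descent, halving X twice.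
  2∣cubic : ∀ k m b₆ X → X * X * X + + 2 * (+ 2 * k * (X * X) + + 8 * m * X + + 8 * b₆) ≡ + 0 → + 2 ∣ b₆
  2∣cubic k m b₆ X root = step₁ X
    (∣cube⇒∣ prime[2] X (x+2y≡0⇒2∣x (X * X * X) (+ 2 * k * (X * X) + + 8 * m * X + + 8 * b₆) root)) root
    where
    reduce₁ : ∀ k m b₆ Y →
      Y * + 2 * (Y * + 2) * (Y * + 2) + + 2 * (+ 2 * k * (Y * + 2 * (Y * + 2)) + + 8 * m * (Y * + 2) + + 8 * b₆)
      ≡ + 8 * (Y * Y * Y + + 2 * (k * (Y * Y) + + 2 * m * Y + b₆))
    reduce₁ = solve-∀
    reduce₂ : ∀ k m b₆ Z →
      Z * + 2 * (Z * + 2) * (Z * + 2) + + 2 * (k * (Z * + 2 * (Z * + 2)) + + 2 * m * (Z * + 2) + b₆)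
      ≡ + 2 * (b₆ + + 2 * (+ 2 * (Z * Z * Z) + + 2 * k * (Z * Z) + + 2 * m * Z))
    reduce₂ = solve-∀
    step₂ : ∀ Y → + 2 ∣ Y → Y * Y * Y + + 2 * (k * (Y * Y) + + 2 * m * Y + b₆) ≡ + 0 → + 2 ∣ b₆
    step₂ _ (divides Z refl) eq = x+2y≡0⇒2∣x b₆ (+ 2 * (Z * Z * Z) + + 2 * k * (Z * Z) + + 2 * m * Z)
      (ℤₚ.*-cancelˡ-≡ (+ 2) (b₆ + + 2 * (+ 2 * (Z * Z * Z) + + 2 * k * (Z * Z) + + 2 * m * Z)) (+ 0)
        (trans (sym (reduce₂ k m b₆ Z)) eq))
    step₁ : ∀ X → + 2 ∣ X → X * X * X + + 2 * (+ 2 * k * (X * X) + + 8 * m * X + + 8 * b₆) ≡ + 0 → + 2 ∣ b₆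
    step₁ _ (divides Y refl) eq = step₂ Y (∣cube⇒∣ prime[2] Y (x+2y≡0⇒2∣x (Y * Y * Y) (k * (Y * Y) + + 2 * m * Y + b₆) eq′)) eq′
      where
      eq′ : Y * Y * Y + + 2 * (k * (Y * Y) + + 2 * m * Y + b₆) ≡ + 0
      eq′ = ℤₚ.*-cancelˡ-≡ (+ 8) (Y * Y * Y + + 2 * (k * (Y * Y) + + 2 * m * Y + b₆)) (+ 0)
        (trans (sym (reduce₁ k m b₆ Y)) eq)

  -- For X = 2Y the equation divided by 4 reads b₂Y² ≡ 0 modulo 2, so Y is even as well. Once 4 ∣ X,
  -- each of the three terms of B is divisible by 8.
  evenRoot : ∀ b₂ b₄ b₆ X → ¬ + 2 ∣ b₂ → + 2 ∣ X → X * X * X + b₂ * (X * X) + + 8 * b₄ * X + + 16 * b₆ ≡ + 0 →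
    Σ ℤ λ w → + 3 * (X * X) + + 2 * b₂ * X + + 8 * b₄ ≡ + 8 * w
  evenRoot b₂ b₄ b₆ _ 2∤b₂ (divides Y refl) root = step Y 2∣Y
    where
    reduce₁ : ∀ b₂ b₄ b₆ Y →
      Y * + 2 * (Y * + 2) * (Y * + 2) + b₂ * (Y * + 2 * (Y * + 2)) + + 8 * b₄ * (Y * + 2) + + 16 * b₆
      ≡ + 4 * (b₂ * (Y * Y) + + 2 * (Y * Y * Y + + 2 * b₄ * Y + + 2 * b₆))
    reduce₁ = solve-∀
    reduce₂ : ∀ b₂ b₄ Z →
      + 3 * (Z * + 2 * + 2 * (Z * + 2 * + 2)) + + 2 * b₂ * (Z * + 2 * + 2) + + 8 * b₄ ≡ + 8 * (+ 6 * (Z * Z) + b₂ * Z + b₄)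
    reduce₂ = solve-∀
    2∣Y : + 2 ∣ Y
    2∣Y = [ (λ h → contradiction h 2∤b₂) , ∣square⇒∣ prime[2] Y ]′ (euclid b₂ (Y * Y) prime[2]
      (x+2y≡0⇒2∣x (b₂ * (Y * Y)) (Y * Y * Y + + 2 * b₄ * Y + + 2 * b₆)
           (ℤₚ.*-cancelˡ-≡ (+ 4) (b₂ * (Y * Y) + + 2 * (Y * Y * Y + + 2 * b₄ * Y + + 2 * b₆)) (+ 0)
             (trans (sym (reduce₁ b₂ b₄ b₆ Y)) root))))
    step : ∀ Y → + 2 ∣ Y → Σ ℤ λ w → + 3 * (Y * + 2 * (Y * + 2)) + + 2 * b₂ * (Y * + 2) + + 8 * b₄ ≡ + 8 * w
    step _ (divides Z refl) = + 6 * (Z * Z) + b₂ * Z + b₄ , reduce₂ b₂ b₄ Z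

  -- Here 8w is b. With d and e odd, b²e = 256d means v₂(b) = 4; since 8 ∣ b is known, a single
  -- factor 2 remains to be found in w.
  16∥8w : ∀ w e d → ¬ + 2 ∣ e → ¬ + 2 ∣ d → + 8 * w * (+ 8 * w) * e ≡ + 256 * d → + 16 ∣ + 8 * w × ¬ + 32 ∣ + 8 * w
  16∥8w w e d 2∤e 2∤d eq = step w 2∣w eq
    where
    reduce₁ : ∀ w e → + 8 * w * (+ 8 * w) * e ≡ + 64 * (w * w * e)
    reduce₁ = solve-∀
    reduce₂ : ∀ d → + 256 * d ≡ + 64 * (+ 4 * d)
    reduce₂ = solve-∀
    8[2v]≡16v : ∀ v → + 8 * (v * + 2) ≡ v * + 16
    8[2v]≡16v = solve-∀
    reduce₃ : ∀ v e → + 8 * (v * + 2) * (+ 8 * (v * + 2)) * e ≡ + 256 * (v * v * e)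
    reduce₃ = solve-∀
    wwe≡4d : w * w * e ≡ + 4 * d
    wwe≡4d = ℤₚ.*-cancelˡ-≡ (+ 64) (w * w * e) (+ 4 * d) (trans (sym (reduce₁ w e)) (trans eq (reduce₂ d)))
    2∣w : + 2 ∣ w
    2∣w = [ ∣square⇒∣ prime[2] w , (λ h → contradiction h 2∤e) ]′
      (euclid (w * w) e prime[2] (subst (+ 2 ∣_) (sym wwe≡4d) (∣m⇒∣m*n d 2∣4)))
    step : ∀ w → + 2 ∣ w → + 8 * w * (+ 8 * w) * e ≡ + 256 * d → + 16 ∣ + 8 * w × ¬ + 32 ∣ + 8 * w
    step _ (divides v refl) eq = divides v (8[2v]≡16v v) , λ (divides q 8w≡32q) → 2∤v (divides q
        (ℤₚ.*-cancelʳ-≡ v (q * + 2) (+ 16) (trans (sym (8[2v]≡16v v)) (trans 8w≡32q (sym (ℤₚ.*-assoc q (+ 2) (+ 16)))))))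
      where
      vve≡d : v * v * e ≡ d
      vve≡d = ℤₚ.*-cancelˡ-≡ (+ 256) (v * v * e) d (trans (sym (reduce₃ v e)) eq)
      2∤v : ¬ + 2 ∣ v
      2∤v 2∣v = 2∤d (subst (+ 2 ∣_) vve≡d (∣m⇒∣m*n e (∣m⇒∣m*n v 2∣v)))

  256∥e : ∀ b e d → ¬ + 2 ∣ b → ¬ + 2 ∣ d → b * b * e ≡ + 256 * d → + 256 ∣ e × ¬ + 512 ∣ e
  256∥e b e d 2∤b 2∤d eq =
      primePower-cancel prime[2] 8 e (2∤b ∘ ∣square⇒∣ prime[2] b) (subst (+ 256 ∣_) (sym eq) (∣m⇒∣m*n d ∣-refl))
    , λ (divides q e≡) → 2∤d (divides (b * b * q) (ℤₚ.*-cancelˡ-≡ (+ 256) d (b * b * q * + 2)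
        (trans (sym eq) (trans (cong (b * b *_) e≡) (reduce (b * b) q)))))
    where
    reduce : ∀ b q → b * (q * + 512) ≡ + 256 * (b * q * + 2)
    reduce = solve-∀

  cubic-even : ∀ c a₂ a₃ a₄ a₆ X →
      X * X * X + (c * + 2 * (c * + 2) + + 4 * a₂) * (X * X) + + 8 * (+ 2 * a₄ + c * + 2 * a₃) * X + + 16 * (a₃ * a₃ + + 4 * a₆)
      ≡ X * X * X + + 2 * (+ 2 * (c * c + a₂) * (X * X) + + 8 * (a₄ + c * a₃) * X + + 8 * (a₃ * a₃ + + 4 * a₆))
  cubic-even = solve-∀

  -- An even a₁ makes b₂ even, and the integral root makes b₆ even. Every term of Δ contains b₂, b₆
  -- or the coefficient 8.
  a₁-odd : ∀ M X → cubic M X ≡ + 0 → ¬ + 2 ∣ Δᶻ M → ¬ + 2 ∣ ℤWeierstrass.a₁ M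
  a₁-odd M@(mkℤW _ a₂ a₃ a₄ a₆) X root 2∤Δ 2∣a₁@(divides c refl) = 2∤Δ 2∣Δ
    where
    2∣b₂ : + 2 ∣ b₂ᶻ M
    2∣b₂ = ∣m∣n⇒∣m+n (∣m⇒∣m*n (c * + 2) 2∣a₁) (∣m⇒∣m*n a₂ 2∣4)
    2∣b₆ : + 2 ∣ b₆ᶻ M
    2∣b₆ = 2∣cubic (c * c + a₂) (a₄ + c * a₃) (b₆ᶻ M) X (trans (sym (cubic-even c a₂ a₃ a₄ a₆ X)) root)
    2∣Δ : + 2 ∣ Δᶻ M
    2∣Δ = ∣m∣n⇒∣m+n (∣m∣n⇒∣m-n (∣m∣n⇒∣m-n (∣m⇒∣-m (∣m⇒∣m*n (b₈ᶻ M) (∣m⇒∣m*n (b₂ᶻ M) 2∣b₂)))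
                                         (∣m⇒∣m*n (b₄ᶻ M * b₄ᶻ M * b₄ᶻ M) 2∣8))
                               (∣n⇒∣m*n (+ 27) (∣m⇒∣m*n (b₆ᶻ M) 2∣b₆)))
                   (∣n⇒∣m*n (+ 9 * b₂ᶻ M * b₄ᶻ M) 2∣b₆)

  twoAdic : ∀ M X → cubic M X ≡ + 0 → ¬ + 2 ∣ Δᶻ M → TwoAdicShape (A M X) (B M X)
  twoAdic M X root 2∤Δ = [ even , odd ]′ (toSum (+ 2 ∣? X))
    where
    open ℤWeierstrass M
    2∤b₂ : ¬ + 2 ∣ b₂ᶻ M
    2∤b₂ 2∣b₂ = a₁-odd M X root 2∤Δ (∣square⇒∣ prime[2] a₁ (∣m+n∣n⇒∣m 2∣b₂ (∣m⇒∣m*n a₂ 2∣4)))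
    even : + 2 ∣ X → TwoAdicShape (A M X) (B M X)
    even 2∣X = inj₁ (2∤A , subst (λ b → + 16 ∣ b × ¬ + 32 ∣ b) (sym B≡8w)
        (16∥8w w (A M X * A M X - + 4 * B M X) (Δᶻ M) 2∤E 2∤Δ
          (subst (λ b → b * b * (A M X * A M X - + 4 * B M X) ≡ + 256 * Δᶻ M) B≡8w (discriminantAtRoot M X root))))
      where
      2∤A : ¬ + 2 ∣ A M X
      2∤A 2∣A = 2∤b₂ (∣m+n∣n⇒∣m 2∣A (∣n⇒∣m*n (+ 3) 2∣X))
      2∤E : ¬ + 2 ∣ A M X * A M X - + 4 * B M X
      2∤E 2∣E = 2∤A (∣square⇒∣ prime[2] (A M X) (∣m+n∣n⇒∣m 2∣E (∣m⇒∣-m (∣m⇒∣m*n (B M X) 2∣4))))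
      w∃ = evenRoot (b₂ᶻ M) (b₄ᶻ M) (b₆ᶻ M) X 2∤b₂ 2∣X root
      w = proj₁ w∃
      B≡8w = proj₂ w∃
    odd : ¬ + 2 ∣ X → TwoAdicShape (A M X) (B M X)
    odd 2∤X = inj₂ (2∤B , 256∥e (B M X) (A M X * A M X - + 4 * B M X) (Δᶻ M) 2∤B 2∤Δ (discriminantAtRoot M X root))
      where
      2∤B : ¬ + 2 ∣ B M X
      2∤B 2∣B = [ 2∤3 , 2∤X ∘ ∣square⇒∣ prime[2] X ]′ (euclid (+ 3) (X * X) prime[2]
        (∣m+n∣n⇒∣m (∣m+n∣n⇒∣m 2∣B (∣m⇒∣m*n (b₄ᶻ M) 2∣8)) (∣m⇒∣m*n X (∣m⇒∣m*n (b₂ᶻ M) ∣-refl))))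

  -- Minimal pairs and their comparison at a prime

  infix 8 _² _⁴
  _² _⁴ : ℤ → ℤ
  x ² = x * x
  x ⁴ = x ² * x ²

  disc : ℤ → ℤ → ℤ
  disc a b = a * a - + 4 * b

  Minimal : ℤ → ℤ → Set
  Minimal a b = ∀ k → 1 ℕ.< k → ¬ (+ (k ℕ.^ 2) ∣ a × + (k ℕ.^ 4) ∣ b)

  pos-² : ∀ k → + (k ℕ.^ 2) ≡ (+ k) ²
  pos-² k = trans (cong (λ t → + (k ℕ.* t)) (ℕₚ.*-identityʳ k)) (ℤₚ.pos-* k k)

  pos-⁴ : ∀ k → + (k ℕ.^ 4) ≡ (+ k) ⁴
  pos-⁴ k = trans (cong +_ (ℕₚ.^-distribˡ-+-* k 2 2)) (trans (ℤₚ.pos-* (k ℕ.^ 2) (k ℕ.^ 2)) (cong₂ _*_ (pos-² k) (pos-² k)))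

  ∣⇒^2∣² : ∀ {k n} x → + k ∣ n → + (k ℕ.^ 2) ∣ n ² * x
  ∣⇒^2∣² {k} x (divides q refl) = divides (q * q * x) (trans (rearrange q (+ k) x) (cong (q * q * x *_) (sym (pos-² k))))
    where
    rearrange : ∀ q k x → (q * k) * (q * k) * x ≡ q * q * x * (k * k)
    rearrange = solve-∀

  ∣⇒^4∣⁴ : ∀ {k n} x → + k ∣ n → + (k ℕ.^ 4) ∣ n ⁴ * x
  ∣⇒^4∣⁴ {k} x (divides q refl) = divides (q ⁴ * x) (trans (rearrange q (+ k) x) (cong (q ⁴ * x *_) (sym (pos-⁴ k))))
    where
    rearrange : ∀ q k x → (q * k) * (q * k) * ((q * k) * (q * k)) * x ≡ q * q * (q * q) * x * (k * k * (k * k))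
    rearrange = solve-∀

  ∣^suc : ∀ k n → + k ∣ + (k ℕ.^ suc n)
  ∣^suc k n = divides (+ (k ℕ.^ n)) (trans (ℤₚ.pos-* k (k ℕ.^ n)) (ℤₚ.*-comm (+ k) (+ (k ℕ.^ n))))

  abs≢0 : ∀ {z} → z ≢ + 0 → ℕ.NonZero (abs z)
  abs≢0 {z} z≢0 = ℕ.≢-nonZero (z≢0 ∘ ℤₚ.∣i∣≡0⇒i≡0)

  record MinimalForm (a b : ℤ) : Set where
    field
      factor a′ b′ : ℤ
      factor≢0     : factor ≢ + 0
      a≡           : a ≡ factor ² * a′
      b≡           : b ≡ factor ⁴ * b′
      b′≢0         : b′ ≢ + 0
      minimal      : Minimal a′ b′

  minimalForm : ∀ a b → b ≢ + 0 → MinimalForm a b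
  minimalForm a b = go a b (<-wellFounded (abs b))
    where
    go : ∀ a b → Acc ℕ._<_ (abs b) → b ≢ + 0 → MinimalForm a b
    go a b (acc rec) b≢0
      -- As b ≠ 0, k⁴ ∣ b gives k ≤ |b|, so the search below |b| + 1 misses no k.
      with ℕₚ.anyUpTo? (λ k → (1 ℕ.<? k) ×-dec ((+ (k ℕ.^ 2) ∣? a) ×-dec (+ (k ℕ.^ 4) ∣? b))) (suc (abs b))
    ... | no none = record
      { factor = + 1 ; a′ = a ; b′ = b ; factor≢0 = λ ()
      ; a≡ = sym (ℤₚ.*-identityˡ a) ; b≡ = sym (ℤₚ.*-identityˡ b) ; b′≢0 = b≢0
      ; minimal = λ k 1<k (k²∣a , k⁴∣b) →
          none (k , s≤s (ℕᵈ.∣⇒≤ {{abs≢0 b≢0}} (∣⇒∣ᵤ (∣-trans (∣^suc k 3) k⁴∣b))) , 1<k , k²∣a , k⁴∣b) }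
    ... | yes (k , _ , 1<k , divides a₁ a≡ , divides b₁ b≡) = extend (go a₁ b₁ (rec smaller) b₁≢0)
      where
      b₁≢0 : b₁ ≢ + 0
      b₁≢0 refl = b≢0 (trans b≡ (ℤₚ.*-zeroˡ (+ (k ℕ.^ 4))))
      instance
        k-nonZero : ℕ.NonZero k
        k-nonZero = ℕ.>-nonZero (ℕₚ.<-trans (s≤s z≤n) 1<k)
      smaller : abs b₁ ℕ.< abs b
      smaller = subst (abs b₁ ℕ.<_) (sym (trans (cong abs b≡) (ℤₚ.abs-* b₁ (+ (k ℕ.^ 4)))))
        (ℕₚ.m<m*n (abs b₁) (k ℕ.^ 4) {{abs≢0 b₁≢0}} (ℕₚ.<-≤-trans 1<k (ℕₚ.m≤m*n k (k ℕ.^ 3) {{ℕₚ.m^n≢0 k 3}})))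
      k≢0 : + k ≢ + 0
      k≢0 = ℕ.≢-nonZero⁻¹ k ∘ ℤₚ.+-injective
      rearrange₂ : ∀ f a k → f * f * a * (k * k) ≡ (f * k) * (f * k) * a
      rearrange₂ = solve-∀
      rearrange₄ : ∀ f b k → f * f * (f * f) * b * (k * k * (k * k)) ≡ (f * k) * (f * k) * ((f * k) * (f * k)) * b
      rearrange₄ = solve-∀
      extend : MinimalForm a₁ b₁ → MinimalForm a b
      extend m = record
        { factor = factor * + k ; a′ = a′ ; b′ = b′
        ; factor≢0 = [ factor≢0 , k≢0 ]′ ∘ ℤₚ.i*j≡0⇒i≡0∨j≡0 factor
        ; a≡ = trans a≡ (trans (cong₂ _*_ (MinimalForm.a≡ m) (pos-² k)) (rearrange₂ factor a′ (+ k)))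
        ; b≡ = trans b≡ (trans (cong₂ _*_ (MinimalForm.b≡ m) (pos-⁴ k)) (rearrange₄ factor b′ (+ k)))
        ; b′≢0 = b′≢0 ; minimal = minimal }
        where open MinimalForm m using (factor; a′; b′; factor≢0; b′≢0; minimal)

  -- (a , b) and (a′ , b′) define Y² = X³ + aX² + bX up to the scaling λ = m / n : a′ = λ²a and b′ = λ⁴b.
  record _∼_ (ab ab′ : ℤ × ℤ) : Set where
    field
      m n     : ℤ
      a∼      : n ² * proj₁ ab′ ≡ m ² * proj₁ ab
      b∼      : n ⁴ * proj₂ ab′ ≡ m ⁴ * proj₂ ab
      coprime : Coprime (abs m) (abs n)

  ∤-⁴ : ∀ {ℓ} → Prime ℓ → ∀ {m} → ¬ + ℓ ∣ m → ¬ + ℓ ∣ m ⁴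
  ∤-⁴ pr {m} ∤m = ∤m ∘ ∣square⇒∣ pr m ∘ ∣square⇒∣ pr (m ²)

  -- Both (a , b) and (a′ , b′) are minimal at ℓ, so m and n are prime to ℓ.
  module Transfer {a b a′ b′} (min : Minimal a b) (ab∼ab′ : (a , b) ∼ (a′ , b′))
                  {ℓ} (pr : Prime ℓ) (min′ : ¬ (+ (ℓ ℕ.^ 2) ∣ a′ × + (ℓ ℕ.^ 4) ∣ b′)) where
    open _∼_ ab∼ab′

    notBoth : ¬ (+ ℓ ∣ m × + ℓ ∣ n)
    notBoth (∣m , ∣n) = ¬prime[1] (subst Prime (coprime (∣⇒∣ᵤ ∣m , ∣⇒∣ᵤ ∣n)) pr)

    ∤n : ¬ + ℓ ∣ n
    -- If ℓ ∣ n, then m is prime to ℓ, and n²a′ = m²a and n⁴b′ = m⁴b give ℓ² ∣ a and ℓ⁴ ∣ b. The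
    -- argument for m is symmetric and contradicts the minimality of (a′ , b′) at ℓ.
    ∤n ∣n = min ℓ (ℕ.nonTrivial⇒n>1 ℓ {{prime⇒nonTrivial pr}})
      ( primePower-cancel pr 2 a (∤m ∘ ∣square⇒∣ pr m) (subst (+ (ℓ ℕ.^ 2) ∣_) a∼ (∣⇒^2∣² a′ ∣n))
      , primePower-cancel pr 4 b (∤-⁴ pr ∤m) (subst (+ (ℓ ℕ.^ 4) ∣_) b∼ (∣⇒^4∣⁴ b′ ∣n)))
      where
      ∤m : ¬ + ℓ ∣ m
      ∤m ∣m = notBoth (∣m , ∣n)

    ∤m : ¬ + ℓ ∣ m
    ∤m ∣m = min′
      ( primePower-cancel pr 2 a′ (∤n ∘ ∣square⇒∣ pr n) (subst (+ (ℓ ℕ.^ 2) ∣_) (sym a∼) (∣⇒^2∣² a ∣m))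
      , primePower-cancel pr 4 b′ (∤-⁴ pr ∤n) (subst (+ (ℓ ℕ.^ 4) ∣_) (sym b∼) (∣⇒^4∣⁴ b ∣m)))

    disc∼ : n ⁴ * disc a′ b′ ≡ m ⁴ * disc a b
    disc∼ = begin
      n ⁴ * disc a′ b′                                   ≡⟨ expand n a′ b′ ⟩
      (n ² * a′) * (n ² * a′) - + 4 * (n ⁴ * b′)         ≡⟨ cong₂ (λ x y → x * x - + 4 * y) a∼ b∼ ⟩
      (m ² * a) * (m ² * a) - + 4 * (m ⁴ * b)            ≡⟨ expand m a b ⟨
      m ⁴ * disc a b                                     ∎
      where
      open ≡-Reasoning
      expand : ∀ n a b → n * n * (n * n) * (a * a - + 4 * b) ≡ (n * n * a) * (n * n * a) - + 4 * (n * n * (n * n) * b)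
      expand = solve-∀

    transfer : ∀ k {f g} → ¬ + ℓ ∣ f → ¬ + ℓ ∣ g → ∀ x x′ → g * x′ ≡ f * x → + (ℓ ℕ.^ k) ∣ x ⇔ + (ℓ ℕ.^ k) ∣ x′
    transfer k {f} {g} ∤f ∤g x x′ eq = mk⇔
      (λ h → primePower-cancel pr k x′ ∤g (subst (+ (ℓ ℕ.^ k) ∣_) (sym eq) (∣n⇒∣m*n f h)))
      (λ h → primePower-cancel pr k x ∤f (subst (+ (ℓ ℕ.^ k) ∣_) eq (∣n⇒∣m*n g h)))

    a-transfer : ∀ k → + (ℓ ℕ.^ k) ∣ a ⇔ + (ℓ ℕ.^ k) ∣ a′
    a-transfer k = transfer k (∤m ∘ ∣square⇒∣ pr m) (∤n ∘ ∣square⇒∣ pr n) a a′ a∼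

    b-transfer : ∀ k → + (ℓ ℕ.^ k) ∣ b ⇔ + (ℓ ℕ.^ k) ∣ b′
    b-transfer k = transfer k (∤-⁴ pr ∤m) (∤-⁴ pr ∤n) b b′ b∼

    disc-transfer : ∀ k → + (ℓ ℕ.^ k) ∣ disc a b ⇔ + (ℓ ℕ.^ k) ∣ disc a′ b′
    disc-transfer k = transfer k (∤-⁴ pr ∤m) (∤-⁴ pr ∤n) (disc a b) (disc a′ b′) disc∼

  ^1≡ : ∀ ℓ → + (ℓ ℕ.^ 1) ≡ + ℓ
  ^1≡ ℓ = cong +_ (ℕₚ.*-identityʳ ℓ)

  TwoAdicShape⇒minimal : ∀ {a b} → TwoAdicShape a b → ¬ (+ 4 ∣ a × + 16 ∣ b)
  TwoAdicShape⇒minimal (inj₁ (2∤a , _)) (4∣a , _) = 2∤a (∣-trans 2∣4 4∣a)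
  TwoAdicShape⇒minimal (inj₂ (2∤b , _)) (_ , 16∣b) = 2∤b (∣-trans (divides (+ 8) refl) 16∣b)

  twoAdic-transfer : ∀ {a b a′ b′} → Minimal a b → (a , b) ∼ (a′ , b′) → TwoAdicShape a′ b′ → TwoAdicShape a b
  twoAdic-transfer min ab∼ h = Sum.map
    (λ (2∤a′ , 16∣b′ , 32∤b′) → 2∤a′ ∘ to (a-transfer 1) , from (b-transfer 4) 16∣b′ , 32∤b′ ∘ to (b-transfer 5))
    (λ (2∤b′ , 256∣e′ , 512∤e′) → 2∤b′ ∘ to (b-transfer 1) , from (disc-transfer 8) 256∣e′ , 512∤e′ ∘ to (disc-transfer 9))
    h
    where open Transfer min ab∼ prime[2] (TwoAdicShape⇒minimal h)

  -- Good and multiplicative reduction at odd primes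

  ∤2⇒∤256 : ∀ {ℓ} → Prime ℓ → ¬ + ℓ ∣ + 2 → ¬ + ℓ ∣ + 256
  ∤2⇒∤256 pr ∤2 = ∤2 ∘ ∣square⇒∣ pr (+ 2) ∘ ∣square⇒∣ pr (+ 4) ∘ ∣square⇒∣ pr (+ 16)

  module _ {a b} (min : Minimal a b) {M X} (root : cubic M X ≡ + 0) (ab∼ : (a , b) ∼ (A M X , B M X))
           {ℓ} (pr : Prime ℓ) where

    private
      a′ = A M X
      b′ = B M X
      module FirstPower (min′ : ¬ (+ (ℓ ℕ.^ 2) ∣ a′ × + (ℓ ℕ.^ 4) ∣ b′)) where
        open Transfer min ab∼ pr min′
        b⇔ : + ℓ ∣ b ⇔ + ℓ ∣ b′
        b⇔ = subst (λ t → t ∣ b ⇔ t ∣ b′) (^1≡ ℓ) (b-transfer 1)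
        e⇔ : + ℓ ∣ disc a b ⇔ + ℓ ∣ disc a′ b′
        e⇔ = subst (λ t → t ∣ disc a b ⇔ t ∣ disc a′ b′) (^1≡ ℓ) (disc-transfer 1)

    -- At odd ℓ the 256 in b′²e′ = 256Δ is harmless, so ℓ divides neither b′ nor e′. In particular
    -- ℓ⁴ ∤ b′, so the local pair is minimal at ℓ and the comparison applies.
    good-transfer : ¬ + ℓ ∣ + 2 → ¬ + ℓ ∣ Δᶻ M → ¬ + ℓ ∣ b × ¬ + ℓ ∣ disc a b
    good-transfer ∤2 ∤Δ = ∤b′ ∘ to b⇔ , ∤e′ ∘ to e⇔
      where
      ∤256Δ : ¬ + ℓ ∣ b′ * b′ * disc a′ b′
      ∤256Δ h = [ ∤2⇒∤256 pr ∤2 , ∤Δ ]′ (euclid (+ 256) (Δᶻ M) pr (subst (+ ℓ ∣_) (discriminantAtRoot M X root) h))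
      ∤b′ : ¬ + ℓ ∣ b′
      ∤b′ h = ∤256Δ (∣m⇒∣m*n (disc a′ b′) (∣m⇒∣m*n b′ h))
      ∤e′ : ¬ + ℓ ∣ disc a′ b′
      ∤e′ h = ∤256Δ (∣n⇒∣m*n (b′ * b′) h)
      min′ : ¬ (+ (ℓ ℕ.^ 2) ∣ a′ × + (ℓ ℕ.^ 4) ∣ b′)
      min′ (_ , h) = ∤b′ (∣-trans (∣^suc ℓ 3) h)
      open FirstPower min′

    -- ℓ divides b′²e′ = 256Δ, hence b′ or e′. It does not divide both, because c₄ = e′ + b′. A pair
    -- that is not minimal at ℓ would have ℓ dividing both, so the local pair is minimal.
    multiplicative-transfer : + ℓ ∣ Δᶻ M → ¬ + ℓ ∣ c₄ᶻ M →
      (+ ℓ ∣ b ⊎ + ℓ ∣ disc a b) × ¬ (+ ℓ ∣ b × + ℓ ∣ disc a b)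
    multiplicative-transfer ∣Δ ∤c₄ = Sum.map (from b⇔) (from e⇔) one , λ (∣b , ∣e) → notBoth (to b⇔ ∣b , to e⇔ ∣e)
      where
      one : + ℓ ∣ b′ ⊎ + ℓ ∣ disc a′ b′
      one = Sum.map₁ (∣square⇒∣ pr b′) (euclid (b′ * b′) (disc a′ b′) pr
        (subst (+ ℓ ∣_) (sym (discriminantAtRoot M X root)) (∣n⇒∣m*n (+ 256) ∣Δ)))
      split : ∀ a b → a * a - + 3 * b ≡ a * a - + 4 * b + b
      split = solve-∀
      notBoth : ¬ (+ ℓ ∣ b′ × + ℓ ∣ disc a′ b′)
      notBoth (∣b′ , ∣e′) = ∤c₄ (subst (+ ℓ ∣_) (sym (trans (c₄≡ M X) (split a′ b′))) (∣m∣n⇒∣m+n ∣e′ ∣b′))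
      min′ : ¬ (+ (ℓ ℕ.^ 2) ∣ a′ × + (ℓ ℕ.^ 4) ∣ b′)
      min′ (h₂ , h₄) = notBoth (∣b′ , ∣m∣n⇒∣m-n (∣m⇒∣m*n a′ ∣a′) (∣n⇒∣m*n (+ 4) ∣b′))
        where
        ∣a′ = ∣-trans (∣^suc ℓ 1) h₂
        ∣b′ = ∣-trans (∣^suc ℓ 3) h₄
      open FirstPower min′

  -- Integers with no prime divisors other than p and q

  prime∣prime⇒≡ : ∀ {p r} → Prime p → Prime r → p ℕᵈ.∣ r → p ≡ r
  prime∣prime⇒≡ {p} {r} pr pr′ p∣r with prime⇒irreducible pr′ p∣r
  ... | inj₁ refl = contradiction pr ¬prime[1]
  ... | inj₂ p≡r = p≡r

  Smooth : ℕ → ℕ → ℤ → Set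
  Smooth p q z = ∀ ℓ → Prime ℓ → + ℓ ∣ z → ℓ ≡ p ⊎ ℓ ≡ q

  product-of-two : ∀ p q {ns} → All (λ ℓ → ℓ ≡ p ⊎ ℓ ≡ q) ns → ∃ λ i → ∃ λ j → + product ns ≡ (+ p) ^ i * (+ q) ^ j
  product-of-two p q [] = 0 , 0 , refl
  product-of-two p q {_ ∷ ns} (e ∷ es) with product-of-two p q es | e
  ... | i , j , eq | inj₁ refl = suc i , j ,
    trans (ℤₚ.pos-* p (product ns)) (trans (cong (+ p *_) eq)
      (sym (ℤₚ.*-assoc (+ p) ((+ p) ^ i) ((+ q) ^ j))))
  ... | i , j , eq | inj₂ refl = i , suc j ,
    trans (ℤₚ.pos-* q (product ns)) (trans (cong (+ q *_) eq) (shuffle (+ q) ((+ p) ^ i) ((+ q) ^ j)))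
    where
    shuffle : ∀ x y z → x * (y * z) ≡ y * (x * z)
    shuffle = solve-∀

  sgn-abs : ∀ z → ∃ λ s → z ≡ sgn s * + abs z
  sgn-abs (+ n)    = Sign.+ , sym (ℤₚ.*-identityˡ (+ n))
  sgn-abs -[1+ n ] = Sign.- , sym (ℤₚ.-1*i≡-i (+ suc n))

  smooth⇒monomial : ∀ p q z → z ≢ + 0 → Smooth p q z →
    ∃ λ s → ∃ λ i → ∃ λ j → z ≡ sgn s * ((+ p) ^ i * (+ q) ^ j)
  smooth⇒monomial p q z z≢0 smooth =
    let s , z≡ = sgn-abs z
        i , j , eq = product-of-two p q (All.tabulate λ {ℓ} ℓ∈ → smooth ℓ (All.lookup factorsPrime ℓ∈)
                       (∣ᵤ⇒∣ (subst (ℓ ℕᵈ.∣_) (sym isFactorisation) (∈⇒∣product ℓ∈))))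
    in s , i , j , trans z≡ (cong (sgn s *_) (trans (cong +_ isFactorisation) eq))
    where open PrimeFactorisation (factorise (abs z) {{abs≢0 z≢0}})

  -- The four ways in which p and q can each divide exactly one of x and y. Throughout, i + 1 is the
  -- exponent of p and j + 1 that of q. In `left` and `right`, s is the sign of the product and s′
  -- the unit on the other side.
  data Split (p q : ℕ) (x y : ℤ) : Set where
    left     : ∀ s s′ i j → x ≡ sgn s * ((+ p) ^ suc i * (+ q) ^ suc j) → y ≡ sgn s′ → Split p q x y
    right    : ∀ s s′ i j → x ≡ sgn s′ → y ≡ sgn s * ((+ p) ^ suc i * (+ q) ^ suc j) → Split p q x y
    straight : ∀ s s′ i j → x ≡ sgn s * (+ p) ^ suc i → y ≡ sgn s′ * (+ q) ^ suc j → Split p q x y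
    crossed  : ∀ s s′ i j → x ≡ sgn s * (+ q) ^ suc j → y ≡ sgn s′ * (+ p) ^ suc i → Split p q x y

  Divisibility : ℕ → ℤ → ℤ → Set
  Divisibility ℓ x y = (+ ℓ ∣ x ⊎ + ℓ ∣ y) × ¬ (+ ℓ ∣ x × + ℓ ∣ y)

  p∣monomial : ∀ p q s i j → + p ∣ sgn s * ((+ p) ^ suc i * (+ q) ^ j)
  p∣monomial p q s i j = ∣n⇒∣m*n (sgn s) (∣m⇒∣m*n ((+ q) ^ j) (∣m⇒∣m*n ((+ p) ^ i) ∣-refl))

  q∣monomial : ∀ p q s i j → + q ∣ sgn s * ((+ p) ^ i * (+ q) ^ suc j)
  q∣monomial p q s i j = ∣n⇒∣m*n (sgn s) (∣n⇒∣m*n ((+ p) ^ i) (∣m⇒∣m*n ((+ q) ^ j) ∣-refl))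

  ∣⇒∣sgn* : ∀ {k} s {z} → k ∣ sgn s * z → k ∣ z
  ∣⇒∣sgn* Sign.+ {z} h = subst (_ ∣_) (ℤₚ.*-identityˡ z) h
  ∣⇒∣sgn* {k} Sign.- {z} h = subst (k ∣_) (trans (cong -_ (ℤₚ.-1*i≡-i z)) (ℤₚ.neg-involutive z)) (∣m⇒∣-m h)

  ∣^⇒∣ : ∀ {ℓ} → Prime ℓ → ∀ q j → + ℓ ∣ (+ q) ^ j → ℓ ℕᵈ.∣ q
  ∣^⇒∣ pr q zero h = contradiction (subst Prime (ℕᵈ.∣1⇒≡1 (∣⇒∣ᵤ h)) pr) ¬prime[1]
  ∣^⇒∣ pr q (suc j) h = [ ∣⇒∣ᵤ , ∣^⇒∣ pr q j ]′ (euclid (+ q) ((+ q) ^ j) pr h)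

  module _ {p q} (pp : Prime p) (pq : Prime q) (p≢q : p ≢ q) where

    -- Each shape records whether p and q divide z, so that `split` can discard twelve of the
    -- sixteen pairs of shapes by divisibility alone.
    data Monomial (z : ℤ) : Set where
      one : ∀ s → z ≡ sgn s → ¬ + p ∣ z → ¬ + q ∣ z → Monomial z
      p^  : ∀ s i → z ≡ sgn s * (+ p) ^ suc i → + p ∣ z → ¬ + q ∣ z → Monomial z
      q^  : ∀ s j → z ≡ sgn s * (+ q) ^ suc j → ¬ + p ∣ z → + q ∣ z → Monomial z
      p^q^ : ∀ s i j → z ≡ sgn s * ((+ p) ^ suc i * (+ q) ^ suc j) → + p ∣ z → + q ∣ z → Monomial z

    monomial : ∀ z → z ≢ + 0 → Smooth p q z → Monomial z
    monomial z z≢0 smooth with smooth⇒monomial p q z z≢0 smooth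
    ... | s , zero , zero , refl = one s (ℤₚ.*-identityʳ (sgn s)) (∤1 pp ∘ ∣⇒∣sgn* s) (∤1 pq ∘ ∣⇒∣sgn* s)
      where
      ∤1 : ∀ {ℓ} → Prime ℓ → ¬ + ℓ ∣ + 1
      ∤1 pr h = ¬prime[1] (subst Prime (ℕᵈ.∣1⇒≡1 (∣⇒∣ᵤ h)) pr)
    ... | s , suc i , zero , refl = p^ s i (cong (sgn s *_) (ℤₚ.*-identityʳ ((+ p) ^ suc i))) (p∣monomial p q s i 0)
      λ h → p≢q (sym (prime∣prime⇒≡ pq pp (∣^⇒∣ pq p (suc i) (subst (+ q ∣_) (ℤₚ.*-identityʳ ((+ p) ^ suc i)) (∣⇒∣sgn* s h)))))
    ... | s , zero , suc j , refl = q^ s j (cong (sgn s *_) (ℤₚ.*-identityˡ ((+ q) ^ suc j)))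
      (λ h → p≢q (prime∣prime⇒≡ pp pq (∣^⇒∣ pp q (suc j) (subst (+ p ∣_) (ℤₚ.*-identityˡ ((+ q) ^ suc j)) (∣⇒∣sgn* s h)))))
      (q∣monomial p q s 0 j)
    ... | s , suc i , suc j , refl = p^q^ s i j refl (p∣monomial p q s i (suc j)) (q∣monomial p q s (suc i) j)

    split : ∀ {x y} → x ≢ + 0 → y ≢ + 0 → Smooth p q x → Smooth p q y →
      Divisibility p x y → Divisibility q x y → Split p q x y
    split {x} {y} x≢0 y≢0 sx sy (p∣ , ¬p∣) (q∣ , ¬q∣) with monomial x x≢0 sx | monomial y y≢0 sy
    ... | p^q^ s i j ex p∣x q∣x | one s′ ey p∤y q∤y = left s s′ i j ex ey
    ... | one s′ ex p∤x q∤x | p^q^ s i j ey p∣y q∣y = right s s′ i j ex ey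
    ... | p^ s i ex p∣x q∤x | q^ s′ j ey p∤y q∣y    = straight s s′ i j ex ey
    ... | q^ s j ex p∤x q∣x | p^ s′ i ey p∣y q∤y    = crossed s s′ i j ex ey
    ... | one _ _ p∤x q∤x | one _ _ p∤y q∤y = contradiction p∣ [ p∤x , p∤y ]′
    ... | one _ _ p∤x q∤x | p^ _ _ _ p∣y q∤y = contradiction q∣ [ q∤x , q∤y ]′
    ... | one _ _ p∤x q∤x | q^ _ _ _ p∤y q∣y = contradiction p∣ [ p∤x , p∤y ]′
    ... | p^ _ _ _ p∣x q∤x | one _ _ p∤y q∤y = contradiction q∣ [ q∤x , q∤y ]′
    ... | p^ _ _ _ p∣x q∤x | p^ _ _ _ p∣y q∤y = contradiction (p∣x , p∣y) ¬p∣
    ... | p^ _ _ _ p∣x q∤x | p^q^ _ _ _ _ p∣y q∣y = contradiction (p∣x , p∣y) ¬p∣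
    ... | q^ _ _ _ p∤x q∣x | one _ _ p∤y q∤y = contradiction p∣ [ p∤x , p∤y ]′
    ... | q^ _ _ _ p∤x q∣x | q^ _ _ _ p∤y q∣y = contradiction (q∣x , q∣y) ¬q∣
    ... | q^ _ _ _ p∤x q∣x | p^q^ _ _ _ _ p∣y q∣y = contradiction (q∣x , q∣y) ¬q∣
    ... | p^q^ _ _ _ _ p∣x q∣x | p^ _ _ _ p∣y q∤y = contradiction (p∣x , p∣y) ¬p∣
    ... | p^q^ _ _ _ _ p∣x q∣x | q^ _ _ _ p∤y q∣y = contradiction (q∣x , q∣y) ¬q∣
    ... | p^q^ _ _ _ _ p∣x q∣x | p^q^ _ _ _ _ p∣y q∣y = contradiction (p∣x , p∣y) ¬p∣

  -- The equation a² - 64 = ±pⁱqʲ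

  OddPrime : ℕ → Set
  OddPrime p = Prime p × ¬ 2 ℕᵈ.∣ p

  oddPrime⇒∤2 : ∀ {p} → OddPrime p → ¬ p ℕᵈ.∣ 2
  oddPrime⇒∤2 (pr , odd) h = odd (subst (2 ℕᵈ.∣_) (sym (prime∣prime⇒≡ pr prime[2] h)) ℕᵈ.∣-refl)

  ∣double⇒∣ : ∀ {p} → OddPrime p → ∀ m → p ℕᵈ.∣ 2 ℕ.* m → p ℕᵈ.∣ m
  ∣double⇒∣ op m h = [ (λ h → contradiction h (oddPrime⇒∤2 op)) , id ]′ (euclidsLemma 2 m (proj₁ op) h)

  Exceptional : ℕ → Set
  Exceptional N = N ≡ 15 ⊎ N ≡ 21 ⊎ N ≡ 39 ⊎ N ≡ 55

  prime[3] : Prime 3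
  prime[3] = from-yes (prime? 3)
  prime[5] : Prime 5
  prime[5] = from-yes (prime? 5)
  prime[7] : Prime 7
  prime[7] = from-yes (prime? 7)
  prime[11] : Prime 11
  prime[11] = from-yes (prime? 11)
  prime[13] : Prime 13
  prime[13] = from-yes (prime? 13)
  prime[17] : Prime 17
  prime[17] = from-yes (prime? 17)

  -- The origin of the excluded products: 7 + 9, 6 + 10, 5 + 11 and 3 + 13 yield 21, 15, 55 and 39.
  -- For n = 0, 4, 6, 7 the number 8 - n is a power of 2 and has no odd prime divisor.
  sum16⇒exceptional : ∀ {p q} → OddPrime p → OddPrime q → ∀ n → n ℕ.< 8 →
    p ℕᵈ.∣ 8 ℕ.∸ n → q ℕᵈ.∣ 8 ℕ.+ n → Exceptional (p ℕ.* q)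
  sum16⇒exceptional op oq 0 _ hp hq = contradiction (∣double⇒∣ op 2 (∣double⇒∣ op 4 hp)) (oddPrime⇒∤2 op)
  sum16⇒exceptional op oq 1 _ hp hq = inj₂ (inj₁ (cong₂ ℕ._*_ (prime∣prime⇒≡ (proj₁ op) prime[7] hp)
    (prime∣prime⇒≡ (proj₁ oq) prime[3] ([ id , id ]′ (euclidsLemma 3 3 (proj₁ oq) hq)))))
  sum16⇒exceptional op oq 2 _ hp hq = inj₁ (cong₂ ℕ._*_ (prime∣prime⇒≡ (proj₁ op) prime[3] (∣double⇒∣ op 3 hp))
    (prime∣prime⇒≡ (proj₁ oq) prime[5] (∣double⇒∣ oq 5 hq)))
  sum16⇒exceptional op oq 3 _ hp hq = inj₂ (inj₂ (inj₂ (cong₂ ℕ._*_ (prime∣prime⇒≡ (proj₁ op) prime[5] hp)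
    (prime∣prime⇒≡ (proj₁ oq) prime[11] hq))))
  sum16⇒exceptional op oq 4 _ hp hq = contradiction (∣double⇒∣ op 2 hp) (oddPrime⇒∤2 op)
  sum16⇒exceptional op oq 5 _ hp hq = inj₂ (inj₂ (inj₁ (cong₂ ℕ._*_ (prime∣prime⇒≡ (proj₁ op) prime[3] hp)
    (prime∣prime⇒≡ (proj₁ oq) prime[13] hq))))
  sum16⇒exceptional op oq 6 _ hp hq = contradiction hp (oddPrime⇒∤2 op)
  sum16⇒exceptional op oq 7 _ hp hq = contradiction (subst Prime (ℕᵈ.∣1⇒≡1 hp) (proj₁ op)) ¬prime[1]
  sum16⇒exceptional op oq (suc (suc (suc (suc (suc (suc (suc (suc n))))))))
    (s≤s (s≤s (s≤s (s≤s (s≤s (s≤s (s≤s (s≤s ())))))))) hp hq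

  ∣17⇒≡ : ∀ {p} → Prime p → p ℕᵈ.∣ 17 → p ≡ 17
  ∣17⇒≡ pr = prime∣prime⇒≡ pr prime[17]

  ∣15⇒ : ∀ {p} → Prime p → p ℕᵈ.∣ 15 → p ≡ 3 ⊎ p ≡ 5
  ∣15⇒ pr h = Sum.map (prime∣prime⇒≡ pr prime[3]) (prime∣prime⇒≡ pr prime[5]) (euclidsLemma 3 5 pr h)

  twoDivide15 : ∀ {p q} → Prime p → Prime q → p ≢ q → p ℕᵈ.∣ 15 → q ℕᵈ.∣ 15 → p ℕ.* q ≡ 15
  twoDivide15 pp pq p≢q hp hq with ∣15⇒ pp hp | ∣15⇒ pq hq
  ... | inj₁ refl | inj₁ refl = contradiction refl p≢q
  ... | inj₁ refl | inj₂ refl = refl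
  ... | inj₂ refl | inj₁ refl = refl
  ... | inj₂ refl | inj₂ refl = contradiction refl p≢q

  pos-^ : ∀ m n → + (m ℕ.^ n) ≡ (+ m) ^ n
  pos-^ m zero    = refl
  pos-^ m (suc n) = trans (ℤₚ.pos-* m (m ℕ.^ n)) (cong (+ m *_) (pos-^ m n))

  -power≢+suc : ∀ m n k → + suc k ≢ sgn Sign.- * (+ m) ^ n
  -power≢+suc m n k eq = negate (m ℕ.^ n) (trans eq (trans (ℤₚ.-1*i≡-i ((+ m) ^ n)) (cong -_ (sym (pos-^ m n)))))
    where
    negate : ∀ j → + suc k ≢ - + j
    negate zero ()
    negate (suc j) ()

  distance : ∀ s P Q n → + n - + 8 ≡ sgn s * P → + (8 ℕ.+ n) ≡ sgn Sign.+ * Q → s ≡ Sign.+ →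
    abs (P - Q) ≡ 16 × abs (Q - P) ≡ 16
  distance _ P Q n eP eQ refl =
    cong abs (trans (cong₂ _-_ P≡ Q≡) (minus (+ n))) , cong abs (trans (cong₂ _-_ Q≡ P≡) (plus (+ n)))
    where
    P≡ : P ≡ + n - + 8
    P≡ = sym (trans eP (ℤₚ.*-identityˡ P))
    Q≡ : Q ≡ + 8 + + n
    Q≡ = sym (trans eQ (ℤₚ.*-identityˡ Q))
    minus : ∀ n → n - + 8 - (+ 8 + n) ≡ -[1+ 15 ]
    minus = solve-∀
    plus : ∀ n → + 8 + n - (n - + 8) ≡ + 16
    plus = solve-∀

  n-8≡-P⇒n<8 : ∀ p i n → Prime p → + n - + 8 ≡ sgn Sign.- * (+ p) ^ i → n ℕ.< 8
  n-8≡-P⇒n<8 p i n pr eq = [ id , (λ 8≤n → contradiction eq (big 8≤n)) ]′ (ℕₚ.<-≤-connex n 8)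
    where
    instance
      p-nonZero : ℕ.NonZero p
      p-nonZero = prime⇒nonZero pr
    P-positive : + suc (ℕ.pred (p ℕ.^ i)) ≡ (+ p) ^ i
    P-positive = trans (cong +_ (ℕₚ.suc-pred (p ℕ.^ i) {{ℕₚ.m^n≢0 p i}})) (pos-^ p i)
    big : 8 ℕ.≤ n → + n - + 8 ≢ sgn Sign.- * (+ p) ^ i
    big 8≤n e with trans (sym (trans (ℤₚ.m-n≡m⊖n n 8) (ℤₚ.⊖-≥ 8≤n)))
                     (trans e (trans (ℤₚ.-1*i≡-i ((+ p) ^ i)) (cong -_ (sym P-positive))))
    ... | ()

  sum16⇒⊥ : ∀ {p q} → OddPrime p → OddPrime q → ¬ Exceptional (p ℕ.* q) → ∀ n i j →
    + n - + 8 ≡ sgn Sign.- * (+ p) ^ suc i → + (8 ℕ.+ n) ≡ sgn Sign.+ * (+ q) ^ suc j → ⊥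
  sum16⇒⊥ {p} {q} op oq ¬exc n i j ex ey = ¬exc (sum16⇒exceptional op oq n n<8
    (subst (p ℕᵈ.∣_) (trans (cong abs (ℤₚ.m-n≡m⊖n n 8)) (ℤₚ.∣⊖∣-< n<8))
      (∣⇒∣ᵤ (subst (+ p ∣_) (sym ex) (∣n⇒∣m*n (sgn Sign.-) (∣m⇒∣m*n ((+ p) ^ i) ∣-refl)))))
    (∣⇒∣ᵤ (subst (+ q ∣_) (sym ey) (∣n⇒∣m*n (sgn Sign.+) (∣m⇒∣m*n ((+ q) ^ j) ∣-refl)))))
    where
    n<8 : n ℕ.< 8
    n<8 = n-8≡-P⇒n<8 p (suc i) n (proj₁ op) ex

  module _ {p q} (op : OddPrime p) (oq : OddPrime q) (p≢q : p ≢ q) (¬exc : ¬ Exceptional (p ℕ.* q)) where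

    private
      pp = proj₁ op
      pq = proj₁ oq

    ¬exc′ : ¬ Exceptional (q ℕ.* p)
    ¬exc′ = ¬exc ∘ subst Exceptional (ℕₚ.*-comm q p)

    -- Applied with n = |a|, so that the factor 8 + n is visibly positive and only n - 8 can be
    -- negative.
    difference-of-squares : ∀ n → Split p q (+ n - + 8) (+ (8 ℕ.+ n)) → HasSolution p q
    -- 8 + n is at least 8, hence not ±1.
    difference-of-squares n (left s Sign.+ i j ex ())
    difference-of-squares n (left s Sign.- i j ex ())
    -- n - 8 = 1 makes the other factor 17, a prime, which cannot be divisible by both p and q.
    difference-of-squares n (right s Sign.+ i j ex ey) = contradiction
      (trans (∣17⇒≡ pp (∣⇒∣ᵤ p∣17)) (sym (∣17⇒≡ pq (∣⇒∣ᵤ q∣17)))) p≢q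
      where
      y≡17 : + (8 ℕ.+ n) ≡ + 17
      y≡17 = trans (shift (+ n)) (cong (_+ + 16) ex)
        where
        shift : ∀ n → + 8 + n ≡ n - + 8 + + 16
        shift = solve-∀
      p∣17 = subst (+ p ∣_) (trans (sym ey) y≡17) (p∣monomial p q s i (suc j))
      q∣17 = subst (+ q ∣_) (trans (sym ey) y≡17) (q∣monomial p q s (suc i) j)
    -- n - 8 = -1 makes the other factor 15, so p and q are 3 and 5.
    difference-of-squares n (right s Sign.- i j ex ey) = contradiction
      (inj₁ (twoDivide15 pp pq p≢q (∣⇒∣ᵤ p∣15) (∣⇒∣ᵤ q∣15))) ¬exc
      where
      y≡15 : + (8 ℕ.+ n) ≡ + 15
      y≡15 = trans (shift (+ n)) (cong (_+ + 16) ex)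
        where
        shift : ∀ n → + 8 + n ≡ n - + 8 + + 16
        shift = solve-∀
      p∣15 = subst (+ p ∣_) (trans (sym ey) y≡15) (p∣monomial p q s i (suc j))
      q∣15 = subst (+ q ∣_) (trans (sym ey) y≡15) (q∣monomial p q s (suc i) j)
    difference-of-squares n (straight s Sign.- i j ex ey) = contradiction ey (-power≢+suc q (suc j) (7 ℕ.+ n))
    difference-of-squares n (crossed s Sign.- i j ex ey) = contradiction ey (-power≢+suc p (suc i) (7 ℕ.+ n))
    -- The equation |P - Q| = 16 does not involve A, and `+ 0` fills its place.
    difference-of-squares n (straight Sign.+ Sign.+ i j ex ey) =
      + 0 , suc i , suc j , s≤s z≤n , s≤s z≤n ,
        inj₂ (inj₁ (proj₁ (distance Sign.+ ((+ p) ^ suc i) ((+ q) ^ suc j) n ex ey refl)))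
    difference-of-squares n (crossed Sign.+ Sign.+ i j ex ey) =
      + 0 , suc i , suc j , s≤s z≤n , s≤s z≤n ,
        inj₂ (inj₁ (proj₂ (distance Sign.+ ((+ q) ^ suc j) ((+ p) ^ suc i) n ex ey refl)))
    difference-of-squares n (straight Sign.- Sign.+ i j ex ey) = ⊥-elim (sum16⇒⊥ op oq ¬exc n i j ex ey)
    difference-of-squares n (crossed Sign.- Sign.+ i j ex ey) = ⊥-elim (sum16⇒⊥ oq op ¬exc′ n j i ex ey)

    ∤16 : ∀ {ℓ} → OddPrime ℓ → ¬ + ℓ ∣ + 16
    ∤16 oℓ = oddPrime⇒∤2 oℓ ∘ ∣⇒∣ᵤ ∘ ∣square⇒∣ (proj₁ oℓ) (+ 2) ∘ ∣square⇒∣ (proj₁ oℓ) (+ 4)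

    -- The factors |a| - 8 and |a| + 8 differ by 16, so an odd prime divides at most one of them, as
    -- `split` requires.
    square-64 : ∀ a z → a * a - + 64 ≡ z → z ≢ + 0 → Smooth p q z → + p ∣ z → + q ∣ z → HasSolution p q
    square-64 a z eq z≢0 smooth p∣z q∣z = difference-of-squares n
      (split pp pq p≢q x≢0 (λ ())
        (λ ℓ pr h → smooth ℓ pr (subst (+ ℓ ∣_) xy≡z (∣m⇒∣m*n y h)))
        (λ ℓ pr h → smooth ℓ pr (subst (+ ℓ ∣_) xy≡z (∣n⇒∣m*n x h)))
        (divides-one op p∣z) (divides-one oq q∣z))
      where
      n = abs a
      x = + n - + 8
      y = + (8 ℕ.+ n)
      abs² : ∀ a → + abs a * + abs a ≡ a * a
      abs² (+ n)    = refl
      abs² -[1+ n ] = refl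
      factor : ∀ n → (n - + 8) * (+ 8 + n) ≡ n * n - + 64
      factor = solve-∀
      xy≡z : x * y ≡ z
      xy≡z = trans (factor (+ n)) (trans (cong (_- + 64) (abs² a)) eq)
      x≢0 : x ≢ + 0
      x≢0 x≡0 = z≢0 (trans (sym xy≡z) (cong (_* y) x≡0))
      y-x≡16 : ∀ n → + 8 + n - (n - + 8) ≡ + 16
      y-x≡16 = solve-∀
      divides-one : ∀ {ℓ} → OddPrime ℓ → + ℓ ∣ z → Divisibility ℓ x y
      divides-one {ℓ} oℓ ℓ∣z = euclid x y (proj₁ oℓ) (subst (+ ℓ ∣_) (sym xy≡z) ℓ∣z)
        , λ (∣x , ∣y) → ∤16 oℓ (subst (+ ℓ ∣_) (y-x≡16 (+ n)) (∣m∣n⇒∣m-n ∣y ∣x))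

  -- From the two 2-adic shapes to the Diophantine equations

  data Parity (c : ℤ) : Set where
    even : ∀ d → c ≡ d * + 2 → Parity c
    odd  : ∀ d → c ≡ + 1 + d * + 2 → Parity c

  parity : ∀ c → Parity c
  parity c = classify (c ℤᵈ.%ℕ 2) (ℤᵈ.n%ℕd<d c 2) (ℤᵈ.a≡a%ℕn+[a/ℕn]*n c 2)
    where
    classify : ∀ r → r ℕ.< 2 → c ≡ + r + (c ℤᵈ./ℕ 2) * + 2 → Parity c
    classify 0 _ eq = even (c ℤᵈ./ℕ 2) (trans eq (ℤₚ.+-identityˡ _))
    classify 1 _ eq = odd (c ℤᵈ./ℕ 2) eq
    classify (suc (suc r)) (s≤s (s≤s ())) eq

  2∣d[d+1] : ∀ d → + 2 ∣ d * (d + + 1)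
  2∣d[d+1] d with parity d
  ... | even e refl = ∣m⇒∣m*n (d + + 1) (divides e refl)
  ... | odd e refl = ∣n⇒∣m*n d (divides (e + + 1) (lemma e))
    where
    lemma : ∀ e → + 1 + e * + 2 + + 1 ≡ (e + + 1) * + 2
    lemma = solve-∀

  8∣odd²-1 : ∀ c → ¬ + 2 ∣ c → + 8 ∣ c * c - + 1
  8∣odd²-1 c 2∤c = go (parity c)
    where
    expand : ∀ d → (+ 1 + d * + 2) * (+ 1 + d * + 2) - + 1 ≡ + 4 * (d * (d + + 1))
    expand = solve-∀
    go : Parity c → + 8 ∣ c * c - + 1
    go (even d eq) = contradiction (divides d eq) 2∤c
    go (odd d refl) = subst (+ 8 ∣_) (sym (expand d)) (*-monoʳ-∣ (+ 4) (2∣d[d+1] d))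

  sgn-opposite : ∀ s → sgn (opposite s) ≡ - sgn s
  sgn-opposite Sign.+ = refl
  sgn-opposite Sign.- = refl

  a²≥0 : ∀ a → a * a ≡ + (abs a ℕ.* abs a)
  a²≥0 (+ n)    = ℤₚ.+◃n≡+n (n ℕ.* n)
  a²≥0 -[1+ n ] = refl

  equation4 : ∀ a s Q {r} → a * a - + 64 * (sgn s * Q) ≡ r → a * a + sgn (opposite s) * (+ 64 * Q) ≡ r
  equation4 a s Q eq = trans (cong (λ t → a * a + t * (+ 64 * Q)) (sgn-opposite s)) (trans (rearrange a (sgn s) Q) eq)
    where
    rearrange : ∀ a σ Q → a * a + - σ * (+ 64 * Q) ≡ a * a - + 64 * (σ * Q)
    rearrange = solve-∀

  module _ {p q} (op : OddPrime p) (oq : OddPrime q) (p≢q : p ≢ q) (¬exc : ¬ Exceptional (p ℕ.* q)) where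

    -- b = 16x and e = a² - 4b = y.
    case-16∥b : ∀ a x y → a * a - + 64 * x ≡ y → y ≢ + 0 → Smooth p q y → Split p q x y → HasSolution p q ⊎ HasSolution q p
    case-16∥b a x y eq y≢0 smooth (left s s′ i j refl refl) = inj₁
      (a , suc i , suc j , s≤s z≤n , s≤s z≤n , inj₂ (inj₂ (inj₂ (inj₂ (inj₂ (inj₂ (opposite s , s′ , (begin
        a * a + sgn (opposite s) * (+ 64 * P * Q)
          ≡⟨ cong (λ t → a * a + sgn (opposite s) * t) (ℤₚ.*-assoc (+ 64) P Q) ⟩
        a * a + sgn (opposite s) * (+ 64 * (P * Q))  ≡⟨ equation4 a s (P * Q) eq ⟩
        sgn s′                                       ≡⟨ ℤₚ.*-identityʳ (sgn s′) ⟨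
        sgn s′ * + 1                                 ∎))))))))
      where
      open ≡-Reasoning
      P = (+ p) ^ suc i
      Q = (+ q) ^ suc j
    case-16∥b a x y eq y≢0 smooth (right s Sign.+ i j refl y≡) =
      inj₁ (square-64 op oq p≢q ¬exc a y eq y≢0 smooth
        (subst (+ p ∣_) (sym y≡) (p∣monomial p q s i (suc j))) (subst (+ q ∣_) (sym y≡) (q∣monomial p q s (suc i) j)))
    case-16∥b a x y eq y≢0 smooth (right Sign.+ Sign.- i j refl y≡) = inj₁
      (a , suc i , suc j , s≤s z≤n , s≤s z≤n , inj₂ (inj₂ (inj₁ (trans eq (trans y≡ (ℤₚ.*-identityˡ _))))))
    -- a² + 64 is positive and cannot equal -P · Q.
    case-16∥b a x y eq y≢0 smooth (right Sign.- Sign.- i j refl y≡) = ⊥-elim (positive≢negative (begin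
        + (64 ℕ.+ abs a ℕ.* abs a)               ≡⟨ ℤₚ.+-comm (+ 64) (+ (abs a ℕ.* abs a)) ⟩
        + (abs a ℕ.* abs a) + + 64               ≡⟨ cong (_+ + 64) (a²≥0 a) ⟨
        a * a + + 64                             ≡⟨ trans eq y≡ ⟩
        sgn Sign.- * ((+ p) ^ suc i * (+ q) ^ suc j)
          ≡⟨ cong (sgn Sign.- *_) (cong₂ _*_ (pos-^ p (suc i)) (pos-^ q (suc j))) ⟨
        sgn Sign.- * (+ (p ℕ.^ suc i) * + (q ℕ.^ suc j))
          ≡⟨ trans (ℤₚ.-1*i≡-i _) (cong -_ (sym (ℤₚ.pos-* (p ℕ.^ suc i) (q ℕ.^ suc j)))) ⟩
        - + (p ℕ.^ suc i ℕ.* q ℕ.^ suc j) ∎))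
      where
      open ≡-Reasoning
      positive≢negative : ∀ {k j} → + suc k ≢ - + j
      positive≢negative {j = zero} ()
      positive≢negative {j = suc j} ()
    -- The coefficient 64 belongs to the power of p here, so the solution is one for (q , p).
    case-16∥b a x y eq y≢0 smooth (straight s s′ i j refl refl) = inj₂
      (a , suc j , suc i , s≤s z≤n , s≤s z≤n , inj₂ (inj₂ (inj₂ (inj₁ (opposite s , s′ , equation4 a s ((+ p) ^ suc i) eq)))))
    case-16∥b a x y eq y≢0 smooth (crossed s s′ i j refl refl) = inj₁
      (a , suc i , suc j , s≤s z≤n , s≤s z≤n , inj₂ (inj₂ (inj₂ (inj₁ (opposite s , s′ , equation4 a s ((+ q) ^ suc j) eq)))))

  -- The hypothesis multiplied by 4, with A = 2c. The sign is reversed because Q moves from a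
  -- subtracted to an added term.
  equation5 : ∀ c s s′ P Q → c * c - sgn s * Q ≡ + 64 * (sgn s′ * P) →
    c * + 2 * (c * + 2) + sgn (opposite s) * (+ 4 * Q) ≡ sgn s′ * (+ 256 * P)
  equation5 c s s′ P Q eq = begin
    c * + 2 * (c * + 2) + sgn (opposite s) * (+ 4 * Q)
      ≡⟨ cong (λ t → c * + 2 * (c * + 2) + t * (+ 4 * Q)) (sgn-opposite s) ⟩
    c * + 2 * (c * + 2) + - sgn s * (+ 4 * Q)           ≡⟨ rearrange₁ c (sgn s) Q ⟩
    + 4 * (c * c - sgn s * Q)                           ≡⟨ cong (+ 4 *_) eq ⟩
    + 4 * (+ 64 * (sgn s′ * P))                         ≡⟨ rearrange₂ (sgn s′) P ⟩
    sgn s′ * (+ 256 * P)                                ∎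
    where
    open ≡-Reasoning
    rearrange₁ : ∀ c σ Q → c * + 2 * (c * + 2) + - σ * (+ 4 * Q) ≡ + 4 * (c * c - σ * Q)
    rearrange₁ = solve-∀
    rearrange₂ : ∀ σ P → + 4 * (+ 64 * (σ * P)) ≡ σ * (+ 256 * P)
    rearrange₂ = solve-∀

  -- An odd c has c² ≡ 1 modulo 8, and 8 ∣ 64, so sQ ≡ 1 and Q ≡ s modulo 8. The sign in front of 4Q
  -- is the opposite of s, as the side condition demands.
  congruence5 : ∀ c s Q y → ¬ + 2 ∣ c → c * c - sgn s * Q ≡ + 64 * y → + 8 ∣ Q + sgn (opposite s)
  congruence5 c s Q y 2∤c eq = signed s (subst (+ 8 ∣_) x-1≡ (∣m∣n⇒∣m-n (8∣odd²-1 c 2∤c) (∣m⇒∣m*n y (divides (+ 8) refl))))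
    where
    cancel : ∀ c x → c * c - + 1 - (c * c - x) ≡ x - + 1
    cancel = solve-∀
    x-1≡ : c * c - + 1 - + 64 * y ≡ sgn s * Q - + 1
    x-1≡ = trans (cong (λ t → c * c - + 1 - t) (sym eq)) (cancel c (sgn s * Q))
    plus : ∀ Q → + 1 * Q - + 1 ≡ Q + -[1+ 0 ]
    plus = solve-∀
    minus : ∀ Q → - (-[1+ 0 ] * Q - + 1) ≡ Q + + 1
    minus = solve-∀
    signed : ∀ s → + 8 ∣ sgn s * Q - + 1 → + 8 ∣ Q + sgn (opposite s)
    signed Sign.+ h = subst (+ 8 ∣_) (plus Q) h
    signed Sign.- h = subst (+ 8 ∣_) (minus Q) (∣m⇒∣-m h)

  -- a = 2c, b = x and e = a² - 4b = 256y.
  case-256∥disc : ∀ {p q} c x y → ¬ + 2 ∣ c → c * c - x ≡ + 64 * y → Split p q x y → HasSolution p q ⊎ HasSolution q p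
  case-256∥disc {p} {q} c x y 2∤c eq (left s s′ i j refl refl) = inj₁
      (c * + 2 , suc i , suc j , s≤s z≤n , s≤s z≤n , inj₂ (inj₂ (inj₂ (inj₂ (inj₂ (inj₁ (opposite s , s′ , (begin
        c * + 2 * (c * + 2) + sgn (opposite s) * (+ 4 * P * Q)
          ≡⟨ cong (λ t → c * + 2 * (c * + 2) + sgn (opposite s) * t) (ℤₚ.*-assoc (+ 4) P Q) ⟩
        c * + 2 * (c * + 2) + sgn (opposite s) * (+ 4 * (P * Q))
          -- y is ±1, so `equation5` is used with 1 in place of a prime power and with the product P
          -- · Q as its Q.
          ≡⟨ equation5 c s s′ (+ 1) (P * Q) (trans eq (cong (+ 64 *_) (sym (ℤₚ.*-identityʳ (sgn s′))))) ⟩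
        sgn s′ * + 256                                           ∎))))))))
      where
      open ≡-Reasoning
      P = (+ p) ^ suc i
      Q = (+ q) ^ suc j
  case-256∥disc {p} {q} c x y 2∤c eq (right s s′ i j refl refl) = inj₁
      -- Now b = ±1 and e = ±256 P · Q. Dividing a² - 4b = e by 4 leaves c² ∓ 64 P · Q = ±1, so A is
      -- c and not 2c.
      (c , suc i , suc j , s≤s z≤n , s≤s z≤n , inj₂ (inj₂ (inj₂ (inj₂ (inj₂ (inj₂ (opposite s , s′ , (begin
        c * c + sgn (opposite s) * (+ 64 * P * Q)
          ≡⟨ cong (λ t → c * c + t * (+ 64 * P * Q)) (sgn-opposite s) ⟩
        c * c + - sgn s * (+ 64 * P * Q)                         ≡⟨ rearrange₁ c (sgn s) (sgn s′) P Q ⟩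
        (c * c - sgn s′) - + 64 * (sgn s * (P * Q)) + sgn s′
          ≡⟨ cong (λ t → t - + 64 * (sgn s * (P * Q)) + sgn s′) eq ⟩
        + 64 * (sgn s * (P * Q)) - + 64 * (sgn s * (P * Q)) + sgn s′ ≡⟨ rearrange₂ (+ 64 * (sgn s * (P * Q))) (sgn s′) ⟩
        sgn s′ * + 1                               ∎))))))))
      where
      open ≡-Reasoning
      P = (+ p) ^ suc i
      Q = (+ q) ^ suc j
      rearrange₁ : ∀ c σ τ P Q → c * c + - σ * (+ 64 * P * Q) ≡ (c * c - τ) - + 64 * (σ * (P * Q)) + τ
      rearrange₁ = solve-∀
      rearrange₂ : ∀ t τ → t - t + τ ≡ τ * + 1
      rearrange₂ = solve-∀
  case-256∥disc {p} {q} c x y 2∤c eq (straight s s′ i j refl refl) = inj₂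
      (c * + 2 , suc j , suc i , s≤s z≤n , s≤s z≤n , inj₂ (inj₂ (inj₂ (inj₂ (inj₁ (opposite s , s′ ,
        equation5 c s s′ ((+ q) ^ suc j) ((+ p) ^ suc i) eq , ∣⇒∣ᵤ (congruence5 c s ((+ p) ^ suc i) y 2∤c eq)))))))
  case-256∥disc {p} {q} c x y 2∤c eq (crossed s s′ i j refl refl) = inj₁
      (c * + 2 , suc i , suc j , s≤s z≤n , s≤s z≤n , inj₂ (inj₂ (inj₂ (inj₂ (inj₁ (opposite s , s′ ,
        equation5 c s s′ ((+ p) ^ suc i) ((+ q) ^ suc j) eq , ∣⇒∣ᵤ (congruence5 c s ((+ q) ^ suc j) y 2∤c eq)))))))

  -- Combining the conditions at all primes

  ∤⇒≢0 : ∀ {k z} → ¬ k ∣ z → z ≢ + 0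
  ∤⇒≢0 ∤z refl = ∤z (_ ∣0)

  module _ {p q} (op : OddPrime p) (oq : OddPrime q) (p≢q : p ≢ q) (¬exc : ¬ Exceptional (p ℕ.* q)) where

    private
      pp = proj₁ op
      pq = proj₁ oq

    -- A prime divisor of the odd number z is odd, and outside pq good reduction keeps it from
    -- dividing b or e.
    smooth-part : ∀ {b e} → (∀ ℓ → Prime ℓ → ¬ ℓ ℕᵈ.∣ p ℕ.* q → ¬ + ℓ ∣ + 2 → ¬ + ℓ ∣ b × ¬ + ℓ ∣ e) →
      ∀ z → ¬ + 2 ∣ z → (∀ ℓ → + ℓ ∣ z → + ℓ ∣ b ⊎ + ℓ ∣ e) → Smooth p q z
    smooth-part good z 2∤z z∣ ℓ pr ∣z = [ divides-pq , (λ ∤pq → contradiction (z∣ ℓ ∣z) λ h →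
        [ proj₁ (good ℓ pr ∤pq ∤2) , proj₂ (good ℓ pr ∤pq ∤2) ]′ h) ]′ (toSum (ℓ ℕᵈ.∣? p ℕ.* q))
      where
      divides-pq : ℓ ℕᵈ.∣ p ℕ.* q → ℓ ≡ p ⊎ ℓ ≡ q
      divides-pq h = Sum.map (prime∣prime⇒≡ pr pp) (prime∣prime⇒≡ pr pq) (euclidsLemma p q pr h)
      ∤2 : ¬ + ℓ ∣ + 2
      ∤2 h = 2∤z (subst (λ t → + t ∣ z) (prime∣prime⇒≡ pr prime[2] (∣⇒∣ᵤ h)) ∣z)

    ∣*power⇒∣ : ∀ {ℓ} → OddPrime ℓ → ∀ z {k} → (+ ℓ ∣ + k → + ℓ ∣ + 2) → + ℓ ∣ z * + k → + ℓ ∣ z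
    ∣*power⇒∣ oℓ z {k} reduce h =
      [ id , (λ h → contradiction (∣⇒∣ᵤ (reduce h)) (oddPrime⇒∤2 oℓ)) ]′ (euclid z (+ k) (proj₁ oℓ) h)

    solution : ∀ a b → TwoAdicShape a b →
      (∀ ℓ → Prime ℓ → ¬ ℓ ℕᵈ.∣ p ℕ.* q → ¬ + ℓ ∣ + 2 → ¬ + ℓ ∣ b × ¬ + ℓ ∣ disc a b) →
      (∀ ℓ → OddPrime ℓ → ℓ ℕᵈ.∣ p ℕ.* q → Divisibility ℓ b (disc a b)) →
      HasSolution p q ⊎ HasSolution q p
    solution a _ (inj₁ (2∤a , divides x refl , 32∤b)) good bad =
      case-16∥b op oq p≢q ¬exc a x y y≡ (∤⇒≢0 2∤y) smooth-y
        (split pp pq p≢q (∤⇒≢0 2∤x) (∤⇒≢0 2∤y) smooth-x smooth-y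
          (distribute p op (ℕᵈ.m∣m*n q)) (distribute q oq (ℕᵈ.n∣m*n p)))
      where
      b = x * + 16
      y = disc a b
      rearrange : ∀ a x → a * a - + 64 * x ≡ a * a - + 4 * (x * + 16)
      rearrange = solve-∀
      y≡ : a * a - + 64 * x ≡ y
      y≡ = rearrange a x
      2∤x : ¬ + 2 ∣ x
      2∤x (divides w refl) = 32∤b (divides w (ℤₚ.*-assoc w (+ 2) (+ 16)))
      2∤y : ¬ + 2 ∣ y
      2∤y 2∣y = 2∤a (∣square⇒∣ prime[2] a (∣m+n∣n⇒∣m 2∣y (∣m⇒∣-m (∣m⇒∣m*n b 2∣4))))
      smooth-x : Smooth p q x
      smooth-x = smooth-part good x 2∤x (λ ℓ h → inj₁ (∣m⇒∣m*n (+ 16) h))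
      smooth-y : Smooth p q y
      smooth-y = smooth-part good y 2∤y (λ ℓ h → inj₂ h)
      distribute : ∀ ℓ → OddPrime ℓ → ℓ ℕᵈ.∣ p ℕ.* q → Divisibility ℓ x y
      distribute ℓ oℓ h = Sum.map₁ (∣*power⇒∣ oℓ x (∣square⇒∣ (proj₁ oℓ) (+ 2) ∘ ∣square⇒∣ (proj₁ oℓ) (+ 4)))
          (proj₁ (bad ℓ oℓ h))
        , proj₂ (bad ℓ oℓ h) ∘ map₁ (∣m⇒∣m*n (+ 16))
    solution a b (inj₂ (2∤b , divides y disc≡ , 512∤e)) good bad = go a≡2c
      where
      2∤y : ¬ + 2 ∣ y
      2∤y (divides w refl) = 512∤e (divides w (trans disc≡ (ℤₚ.*-assoc w (+ 2) (+ 256))))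
      -- e and 4b are even, hence so are a² and a; this c = a / 2 is what the second shape is solved
      -- for.
      a² : ∀ a b → a * a - + 4 * b + + 4 * b ≡ a * a
      a² = solve-∀
      a≡2c : + 2 ∣ a
      a≡2c = ∣square⇒∣ prime[2] a (subst (+ 2 ∣_) (a² a b)
        (∣m∣n⇒∣m+n (subst (+ 2 ∣_) (sym disc≡) (∣n⇒∣m*n y (divides (+ 128) refl))) (∣m⇒∣m*n b 2∣4)))
      smooth-b : Smooth p q b
      smooth-b = smooth-part good b 2∤b (λ ℓ h → inj₁ h)
      smooth-y : Smooth p q y
      smooth-y = smooth-part good y 2∤y (λ ℓ h → inj₂ (subst (+ ℓ ∣_) (sym disc≡) (∣m⇒∣m*n (+ 256) h)))
      distribute : ∀ ℓ → OddPrime ℓ → ℓ ℕᵈ.∣ p ℕ.* q → Divisibility ℓ b y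
      distribute ℓ oℓ h = Sum.map₂ (λ ∣e → ∣*power⇒∣ oℓ y
            (∣square⇒∣ (proj₁ oℓ) (+ 2) ∘ ∣square⇒∣ (proj₁ oℓ) (+ 4) ∘ ∣square⇒∣ (proj₁ oℓ) (+ 16))
            (subst (+ ℓ ∣_) disc≡ ∣e)) (proj₁ (bad ℓ oℓ h))
        , proj₂ (bad ℓ oℓ h) ∘ map₂ (λ ∣y → subst (+ ℓ ∣_) (sym disc≡) (∣m⇒∣m*n (+ 256) ∣y))
      go : + 2 ∣ a → HasSolution p q ⊎ HasSolution q p
      go (divides c a≡) = case-256∥disc c b y 2∤c c²≡
        (split pp pq p≢q (∤⇒≢0 2∤b) (∤⇒≢0 2∤y) smooth-b smooth-y
          (distribute p op (ℕᵈ.m∣m*n q)) (distribute q oq (ℕᵈ.n∣m*n p)))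
        where
        rearrange₁ : ∀ c b → c * + 2 * (c * + 2) - + 4 * b ≡ + 4 * (c * c - b)
        rearrange₁ = solve-∀
        rearrange₂ : ∀ y → y * + 256 ≡ + 4 * (+ 64 * y)
        rearrange₂ = solve-∀
        c²≡ : c * c - b ≡ + 64 * y
        c²≡ = ℤₚ.*-cancelˡ-≡ (+ 4) (c * c - b) (+ 64 * y)
          (trans (sym (rearrange₁ c b)) (trans (cong (λ a → disc a b) (sym a≡)) (trans disc≡ (rearrange₂ y))))
        rearrange₃ : ∀ c b → c * c - (c * c - b) ≡ b
        rearrange₃ = solve-∀
        2∤c : ¬ + 2 ∣ c
        2∤c 2∣c = 2∤b (subst (+ 2 ∣_) (rearrange₃ c b)
          (∣m∣n⇒∣m-n (∣m⇒∣m*n c 2∣c) (subst (+ 2 ∣_) (sym c²≡) (∣m⇒∣m*n y (divides (+ 32) refl)))))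

  -- Two models of the same curve and point

  twoAdicShape⇒b≢0 : ∀ {a b} → TwoAdicShape a b → b ≢ + 0
  twoAdicShape⇒b≢0 (inj₁ (_ , _ , 32∤b)) = ∤⇒≢0 32∤b
  twoAdicShape⇒b≢0 (inj₂ (2∤b , _))      = ∤⇒≢0 2∤b

  -- The scaling factor from (a , b) to (a′ , b′) is vf / w, and m / n is this fraction in lowest
  -- terms, whence the coprimality. As a may vanish, no quotient a′ / a is formed: both relations
  -- are proved after multiplication by w² or w⁴, which is then cancelled.
  scaled-∼ : ∀ {α β v w} f a b a′ b′ → w ≢ 0ℚ →
    ι (f ² * a) ≡ w ℚ.* w ℚ.* α → ι (f ⁴ * b) ≡ w ℚ.* w ℚ.* (w ℚ.* w) ℚ.* β →
    ι a′ ≡ v ℚ.* v ℚ.* α → ι b′ ≡ v ℚ.* v ℚ.* (v ℚ.* v) ℚ.* β → (a , b) ∼ (a′ , b′)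
  scaled-∼ {α} {β} {v} {w} f a b a′ b′ w≢0 fa fb ea eb = record
    { m = m ; n = n
    ; a∼ = ι-injective {n ² * a′} {m ² * a} (*-cancelˡ-≢0 (*-≢0 w≢0 w≢0) (begin
        w ℚ.* w ℚ.* ι (n ² * a′)
          ≡⟨ cong (w ℚ.* w ℚ.*_) ι-⟦ K n ⊗ K n ⊗ atom a′ (v ℚ.* v ℚ.* α) ea ⟧ ⟩
        w ℚ.* w ℚ.* (ι n ℚ.* ι n ℚ.* (v ℚ.* v ℚ.* α))
          ≡⟨ solve 4 (λ w n v α → w :* w :* (n :* n :* (v :* v :* α))
               := n :* n :* (v :* v) :* (w :* w :* α)) refl w (ι n) v α ⟩
        ι n ℚ.* ι n ℚ.* (v ℚ.* v) ℚ.* (w ℚ.* w ℚ.* α)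
          ≡⟨ cong (ι n ℚ.* ι n ℚ.* (v ℚ.* v) ℚ.*_) (trans (sym fa) ι-⟦ K f ⊗ K f ⊗ K a ⟧) ⟩
        ι n ℚ.* ι n ℚ.* (v ℚ.* v) ℚ.* (ι f ℚ.* ι f ℚ.* ι a)
          ≡⟨ solve 4 (λ n v f a → n :* n :* (v :* v) :* (f :* f :* a)
               := (n :* (v :* f)) :* (n :* (v :* f)) :* a) refl (ι n) v (ι f) (ι a) ⟩
        ι n ℚ.* (v ℚ.* ι f) ℚ.* (ι n ℚ.* (v ℚ.* ι f)) ℚ.* ι a ≡⟨ cong (λ t → t ℚ.* t ℚ.* ι a) nvf≡wm ⟩
        w ℚ.* ι m ℚ.* (w ℚ.* ι m) ℚ.* ι a
          ≡⟨ solve 3 (λ w m a → w :* m :* (w :* m) :* a := w :* w :* (m :* m :* a)) refl w (ι m) (ι a) ⟩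
        w ℚ.* w ℚ.* (ι m ℚ.* ι m ℚ.* ι a)                 ≡⟨ cong (w ℚ.* w ℚ.*_) ι-⟦ K m ⊗ K m ⊗ K a ⟧ ⟨
        w ℚ.* w ℚ.* ι (m ² * a) ∎))
    ; b∼ = ι-injective {n ⁴ * b′} {m ⁴ * b} (*-cancelˡ-≢0 (*-≢0 (*-≢0 w≢0 w≢0) (*-≢0 w≢0 w≢0)) (begin
        w⁴ ℚ.* ι (n ⁴ * b′)
          ≡⟨ cong (w⁴ ℚ.*_) ι-⟦ K n ⊗ K n ⊗ (K n ⊗ K n) ⊗ atom b′ (v ℚ.* v ℚ.* (v ℚ.* v) ℚ.* β) eb ⟧ ⟩
        w⁴ ℚ.* (ι n ℚ.* ι n ℚ.* (ι n ℚ.* ι n) ℚ.* (v ℚ.* v ℚ.* (v ℚ.* v) ℚ.* β))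
          ≡⟨ solve 4 (λ w n v β → w :* w :* (w :* w) :* (n :* n :* (n :* n) :* (v :* v :* (v :* v) :* β))
               := n :* n :* (n :* n) :* (v :* v :* (v :* v)) :* (w :* w :* (w :* w) :* β)) refl w (ι n) v β ⟩
        ι n ℚ.* ι n ℚ.* (ι n ℚ.* ι n) ℚ.* (v ℚ.* v ℚ.* (v ℚ.* v)) ℚ.* (w⁴ ℚ.* β)
          ≡⟨ cong (ι n ℚ.* ι n ℚ.* (ι n ℚ.* ι n) ℚ.* (v ℚ.* v ℚ.* (v ℚ.* v)) ℚ.*_) (trans (sym fb) ι-⟦ K f ⊗ K f ⊗ (K f ⊗ K f) ⊗ K b ⟧) ⟩
        ι n ℚ.* ι n ℚ.* (ι n ℚ.* ι n) ℚ.* (v ℚ.* v ℚ.* (v ℚ.* v)) ℚ.* (ι f ℚ.* ι f ℚ.* (ι f ℚ.* ι f) ℚ.* ι b)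
          ≡⟨ solve 4 (λ n v f b → n :* n :* (n :* n) :* (v :* v :* (v :* v)) :* (f :* f :* (f :* f) :* b)
               := let t = n :* (v :* f) in t :* t :* (t :* t) :* b) refl (ι n) v (ι f) (ι b) ⟩
        (let t = ι n ℚ.* (v ℚ.* ι f) in t ℚ.* t ℚ.* (t ℚ.* t) ℚ.* ι b)
          ≡⟨ cong (λ t → t ℚ.* t ℚ.* (t ℚ.* t) ℚ.* ι b) nvf≡wm ⟩
        (let t = w ℚ.* ι m in t ℚ.* t ℚ.* (t ℚ.* t) ℚ.* ι b)
          ≡⟨ solve 3 (λ w m b → let t = w :* m in t :* t :* (t :* t) :* b
               := w :* w :* (w :* w) :* (m :* m :* (m :* m) :* b)) refl w (ι m) (ι b) ⟩
        w⁴ ℚ.* (ι m ℚ.* ι m ℚ.* (ι m ℚ.* ι m) ℚ.* ι b)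
          ≡⟨ cong (w⁴ ℚ.*_) ι-⟦ K m ⊗ K m ⊗ (K m ⊗ K m) ⊗ K b ⟧ ⟨
        w⁴ ℚ.* ι (m ⁴ * b) ∎))
    ; coprime = ↥-↧-coprime r }
    where
    open ≡-Reasoning
    open ℚ-Solver.+-*-Solver using (solve; _:=_; _:*_)
    instance
      w-nonZero : ℚ.NonZero w
      w-nonZero = ℚ.≢-nonZero w≢0
    w⁴ = w ℚ.* w ℚ.* (w ℚ.* w)
    r = v ℚ.* ι f ℚ.* ℚ.1/ w
    m = ↥ r
    n = ↧ r
    rw≡vf : r ℚ.* w ≡ v ℚ.* ι f
    rw≡vf = trans (ℚₚ.*-assoc (v ℚ.* ι f) (ℚ.1/ w) w)
      (trans (cong (v ℚ.* ι f ℚ.*_) (ℚₚ.*-inverseˡ w)) (ℚₚ.*-identityʳ (v ℚ.* ι f)))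
    nvf≡wm : ι n ℚ.* (v ℚ.* ι f) ≡ w ℚ.* ι m
    nvf≡wm = begin
      ι n ℚ.* (v ℚ.* ι f)  ≡⟨ cong (ι n ℚ.*_) rw≡vf ⟨
      ι n ℚ.* (r ℚ.* w)    ≡⟨ ℚₚ.*-assoc (ι n) r w ⟨
      ι n ℚ.* r ℚ.* w      ≡⟨ cong (ℚ._* w) (↧*≡↥ r) ⟩
      ι m ℚ.* w            ≡⟨ ℚₚ.*-comm (ι m) w ⟩
      w ℚ.* ι m            ∎

  -- Both pairs are scalings of the same α = b₂ + 12x and β = 48x² + 8b₂x + 8b₄, taken on E. The two
  -- models may belong to different primes, so a single minimal pair can be tested against every
  -- local model.
  integralModels-∼ : ∀ {E x ℓ₁ W₁ ℓ₂ W₂} (m₁ : IntegralModel E x ℓ₁ W₁) (m₂ : IntegralModel E x ℓ₂ W₂) →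
    (mf : MinimalForm (IntegralModel.a m₁) (IntegralModel.b m₁)) →
    (MinimalForm.a′ mf , MinimalForm.b′ mf) ∼ (IntegralModel.a m₂ , IntegralModel.b m₂)
  integralModels-∼ {E} {x} m₁ m₂ mf = scaled-∼
    {b₂ E ℚ.+ ι (+ 12) ℚ.* x} {ι (+ 48) ℚ.* x ℚ.* x ℚ.+ ι (+ 8) ℚ.* b₂ E ℚ.* x ℚ.+ ι (+ 8) ℚ.* b₄ E}
    {v} {IntegralModel.v m₁}
    factor a′ b′ (A M X) (B M X) (IntegralModel.v≢0 m₁)
    (subst (λ t → ι t ≡ _) a≡ (IntegralModel.ι-A m₁)) (subst (λ t → ι t ≡ _) b≡ (IntegralModel.ι-B m₁)) ι-A ι-B
    where
    open MinimalForm mf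
    open IntegralModel m₂

  -- Application to the elliptic curve

  module _ {p q} (op : OddPrime p) (oq : OddPrime q) (p≢q : p ≢ q) (¬exc : ¬ Exceptional (p ℕ.* q))
           (E : EllipticCurve) (conductor : HasSquarefreeConductor E (p ℕ.* q)) x (ψ≡0 : ψ₂² (eqn E) x ≡ 0ℚ) where

    solutionFromModel : ∀ {W₂} (m₂ : IntegralModel (eqn E) x 2 W₂) →
      TwoAdicShape (IntegralModel.a m₂) (IntegralModel.b m₂) →
      MinimalForm (IntegralModel.a m₂) (IntegralModel.b m₂) →
      HasSolution p q ⊎ HasSolution q p
    solutionFromModel m₂ twoAdicShape mf = solution op oq p≢q ¬exc a b
        -- The minimal pair comes from the model at 2, whose own pair may be non-minimal at other
        -- primes. For ℓ = 2 it is compared with that same model.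
        (twoAdic-transfer {a} {b} {A M X} {B M X} minimal (integralModels-∼ m₂ m₂ mf) twoAdicShape) good multiplicative
      where
      open IntegralModel m₂ using (M; X)
      open MinimalForm mf using (minimal) renaming (a′ to a; b′ to b)
      good : ∀ ℓ → Prime ℓ → ¬ ℓ ℕᵈ.∣ p ℕ.* q → ¬ + ℓ ∣ + 2 → ¬ + ℓ ∣ b × ¬ + ℓ ∣ disc a b
      good ℓ pr ∤pq ∤2 =
        let W , iso , int , ∤Δ = proj₁ (conductor ℓ pr) ∤pq
            m = integralModel (eqn E) x W pr iso int ψ≡0
        in good′ W m ∤Δ
        where
        good′ : ∀ W (m : IntegralModel (eqn E) x ℓ W) → ¬ DividesAt ℓ (Δ W) → ¬ + ℓ ∣ b × ¬ + ℓ ∣ disc a b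
        good′ W m ∤Δ = good-transfer {a} {b} minimal {IntegralModel.M m} {IntegralModel.X m} (IntegralModel.root m)
          (integralModels-∼ m₂ m mf) pr ∤2 (∤Δ ∘ IntegralModel.∣Δ⇐ m ∘ ∣⇒∣ᵤ)
      multiplicative : ∀ ℓ → OddPrime ℓ → ℓ ℕᵈ.∣ p ℕ.* q → Divisibility ℓ b (disc a b)
      multiplicative ℓ (pr , _) ∣pq =
        let W , iso , int , ∣Δ , ∤c₄ = proj₂ (conductor ℓ pr) ∣pq
            m = integralModel (eqn E) x W pr iso int ψ≡0
        in multiplicative′ W m ∣Δ ∤c₄
        where
        multiplicative′ : ∀ W (m : IntegralModel (eqn E) x ℓ W) → DividesAt ℓ (Δ W) → ¬ DividesAt ℓ (c₄ W) →
          Divisibility ℓ b (disc a b)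
        multiplicative′ W m ∣Δ ∤c₄ = multiplicative-transfer {a} {b} minimal {IntegralModel.M m} {IntegralModel.X m}
          (IntegralModel.root m) (integralModels-∼ m₂ m mf) pr (∣ᵤ⇒∣ (IntegralModel.∣Δ⇒ m ∣Δ))
          (∤c₄ ∘ IntegralModel.∣c₄⇐ m ∘ ∣⇒∣ᵤ)

    solutionFromGoodReduction : GoodReductionAt 2 E → HasSolution p q ⊎ HasSolution q p
    solutionFromGoodReduction (W , iso , int , 2∤Δ) = fromModel (integralModel (eqn E) x W prime[2] iso int ψ≡0)
      where
      fromModel : IntegralModel (eqn E) x 2 W → HasSolution p q ⊎ HasSolution q p
      fromModel m = solutionFromModel m twoAdicShape (minimalForm (A M X) (B M X) (twoAdicShape⇒b≢0 twoAdicShape))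
        where
        open IntegralModel m
        twoAdicShape : TwoAdicShape (A M X) (B M X)
        twoAdicShape = twoAdic M X root (2∤Δ ∘ ∣Δ⇐ ∘ ∣⇒∣ᵤ)

open import Data.Nat using (_*_)
open import Data.Nat.Divisibility using (_∣_)

theorem5 : (p q : ℕ) → Prime p → Prime q → p ≢ q → ¬ (2 ∣ p) → ¬ (2 ∣ q) →
    p * q ≢ 15 → p * q ≢ 21 → p * q ≢ 39 → p * q ≢ 55 →
    Σ EllipticCurve (λ E → HasSquarefreeConductor E (p * q) × HasRationalPointOfOrder2 E) →
    HasSolution p q ⊎ HasSolution q p
theorem5 p q pp pq p≢q 2∤p 2∤q ≢15 ≢21 ≢39 ≢55 (E , conductor , x , y , onCurve , neg) =
  solutionFromGoodReduction (pp , 2∤p) (pq , 2∤q) p≢q [ ≢15 , [ ≢21 , [ ≢39 , ≢55 ]′ ]′ ]′ E conductor x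
    (order2⇒ψ₂²≡0 a₁ a₂ a₃ a₄ a₆ x y onCurve neg)
    -- pq is odd, so the curve has good reduction at 2.
    (proj₁ (conductor 2 prime[2]) (λ h → [ 2∤p , 2∤q ]′ (euclidsLemma p q prime[2] h)))
  where open Weierstrass (eqn E)
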